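{- For every type-$B$ composition $\alpha$ of $n$, the poset $\mathsf{Tam}_{B}(\alpha)$ is a lattice. Moreover, it is a quotient lattice of the weak order on the parabolic quotient $\mathfrak{H}_{\alpha}$, i.e. there is a lattice congruence $\Theta$ on the lattice $(\mathfrak{H}_{\alpha},\leq_{\mathsf{weak}})$ such that the quotient lattice $(\mathfrak{H}_{\alpha},\leq_{\mathsf{weak}})/\Theta$ is isomorphic to $\mathsf{Tam}_{B}(\alpha)$.
   Context: Let $n\geq 1$ and $\pm[n]=\{ -n,\dots,-1,1,\dots,n\}$. The hyperoctahedral group $\mathfrak{H}_n$ is the group of permutations $\pi$ of $\pm[n]$ with $\pi(-a)=-\pi(a)$, with product $(\pi\sigma)(a)=\pi(\sigma(a))$. It is the Coxeter group of type $B_n$ with simple generators $S=\{s_0,\dots,s_{n-1}\}$: $s_0$ exchanges $1$ and $-1$; $s_i$ ($1\le i\le n-1$) exchanges $i$ with $i+1$ and $-i$ with $-i-1$. $\ell_S$ is the Coxeter length. Reflections: $[\![i]\!]$ (exchanging $i,-i$), and for $0<i<j$, $(\!(i\;j)\!)$ (exchanging $i,j$ and $-i,-j$) and $(\!(-j\;i)\!)$ (exchanging $-j,i$ and $j,-i$). The inversion set is $\mathsf{Inv}(\pi)=\{t:\ell_S(\pi t)<\ell_S(\pi)\}$; explicitly $[\![i]\!]\in\mathsf{Inv}(\pi)$ iff $\pi(i)<0$, $(\!(i\;j)\!)\in\mathsf{Inv}(\pi)$ iff $\pi(i)>\pi(j)$, $(\!(-j\;i)\!)\in\mathsf{Inv}(\pi)$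 iff $\pi(-j)>\pi(i)$ ($0<i<j$). The (left) weak order is $u\leq_{\mathsf{weak}}v$ iff $\ell_S(u)+\ell_S(vu^{ -1})=\ell_S(v)$, equivalently $\mathsf{Inv}(u)\subseteq\mathsf{Inv}(v)$. A type-$B$ composition of $n$ is a sequence $(\alpha_1,\dots,\alpha_r)$ of positive integers summing to $n$, possibly preceded by an extra component $0$; it is split if the $0$ is present and join otherwise. Let $p_0=0$, $p_i=\alpha_1+\cdots+\alpha_i$. Let $J_\alpha=\{s_{p_1},\dots,s_{p_{r-1}}\}$, together with $s_0$ if $\alpha$ is split, and $\mathfrak{H}_\alpha=\{w\in\mathfrak{H}_n:\ell_S(ws)>\ell_S(w)\ \forall s\in S\setminus J_\alpha\}$ (minimal length coset representatives); $\mathfrak{H}_\alpha$ carries the restricted weak order. Let $\mathsf{Part}(\alpha)$ be the partition of $\pm[n]$ into the blocks $\{p_{i-1}+1,\dots,p_i\}$ and $\{ -p_i,\dots,-p_{i-1}-1\}$, $1\le i\le r$, except that if $\alpha$ is join the two blocks for $i=1$ are merged into $\{ -p_1,\dots,p_1\}\setminus\{0\}$. (Equivalently, $\pi\in\mathfrak{H}_\alpha$ iff $\pi$ is increasing on each block.) For $x\in\pm[n]$ put $x^+=x+1$ if $x\neq-1$ and $(-1)^+=1$. If $\alpha$ is split, a type-$B$ $(\alpha,231)$-split pattern of $\pi\in\mathfrak{H}_\alpha$ is a triple $i<j<k$ in $\pm[n]$ lying in pairwise different blocks of $\mathsf{Part}(\alpha)$ with $j>0$, $\pi(i)=\pi(k)^+$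 and $\pi(i)<\pi(j)$. If $\alpha$ is join, a type-$B$ $(\alpha,231)$-join pattern is a triple $i<j<k$ in $\pm[n]$ in pairwise different blocks with $j>0$, $\pi(i)=\pi(k)^+$, and either ($j>\alpha_1$ and $\pi(j)>\pi(i)$) or ($0<j\le\alpha_1$ and $\pi(j)<\pi(k)$). $\mathfrak{H}_\alpha(231)$ is the set of $\pi\in\mathfrak{H}_\alpha$ having no such split pattern (if $\alpha$ split) resp. join pattern (if $\alpha$ join), and $\mathsf{Tam}_B(\alpha)=(\mathfrak{H}_\alpha(231),\leq_{\mathsf{weak}})$. -}

module Defs where

open import Data.Bool using (Bool; true; false; if_then_else_)
open import Data.Nat as ℕ using (ℕ; zero; suc; _≤ᵇ_; _∸_)
open import Data.Integer as ℤ using (ℤ; +_; -[1+_]; -_; ∣_∣; 0ℤ; 1ℤ)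
open import Data.List using (List; []; _∷_; map; length)
open import Data.Nat.ListAction using (sum)
open import Data.List.Relation.Unary.All using (All)
open import Data.List.Relation.Unary.Unique.Propositional using (Unique)
open import Data.List.Membership.Propositional using (_∈_)
open import Data.Product using (Σ; ∃; _×_; _,_)
open import Data.Sum using (_⊎_)
open import Relation.Nullary using (¬_)
open import Relation.Binary.PropositionalEquality using (_≡_; _≢_)
open import Function.Bundles using (_⇔_)

-- Signed permutations of ±[n] = {-n,…,-1,1,…,n} ⊆ ℤ.
-- A signed permutation π is encoded by the list [π(1), …, π(n)];
-- π(-a) = -π(a) and (as a convention) π(0) = 0.

InPM : ℕ → ℤ → Set
InPM n x = (x ≢ 0ℤ) × (∣ x ∣ ℕ.≤ n)

IsSPerm : ℕ → List ℤ → Set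
IsSPerm n π = (length π ≡ n) × All (InPM n) π × Unique (map ∣_∣ π)

nth : List ℤ → ℕ → ℤ
nth []       _       = 0ℤ
nth (x ∷ xs) zero    = x
nth (x ∷ xs) (suc k) = nth xs k

ap : List ℤ → ℤ → ℤ
ap π (+ zero)    = 0ℤ
ap π (+ (suc k)) = nth π k
ap π -[1+ k ]    = - (nth π k)

data Refl : Set where
  ⟦_⟧    : ℕ → Refl          -- ⟦ i ⟧   : exchanges i and -i
  ⦅_,_⦆  : ℕ → ℕ → Refl      -- ⦅ i , j ⦆ : ((i j)),  0 < i < j
  ⦅-_,_⦆ : ℕ → ℕ → Refl      -- ⦅- j , i ⦆ : ((-j i)), 0 < i < j

ValidRefl : ℕ → Refl → Set
ValidRefl n ⟦ i ⟧      = (1 ℕ.≤ i) × (i ℕ.≤ n)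
ValidRefl n ⦅ i , j ⦆  = (1 ℕ.≤ i) × (i ℕ.< j) × (j ℕ.≤ n)
ValidRefl n ⦅- j , i ⦆ = (1 ℕ.≤ i) × (i ℕ.< j) × (j ℕ.≤ n)

Inv : List ℤ → Refl → Set
Inv π ⟦ i ⟧      = ap π (+ i) ℤ.< 0ℤ
Inv π ⦅ i , j ⦆  = ap π (+ j) ℤ.< ap π (+ i)
Inv π ⦅- j , i ⦆ = ap π (+ i) ℤ.< ap π (- (+ j))

_≤weak[_]_ : List ℤ → ℕ → List ℤ → Set
u ≤weak[ n ] v = ∀ t → ValidRefl n t → Inv u t → Inv v t

record TypeBComp (n : ℕ) : Set where
  field
    split : Bool              -- true iff the extra component 0 is present
    parts : List ℕ
    parts-pos : All (λ a → 1 ℕ.≤ a) parts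
    parts-sum : sum parts ≡ n
open TypeBComp public

cuts : List ℕ → List ℕ
cuts []           = []
cuts (a ∷ [])     = []
cuts (a ∷ b ∷ as) = a ∷ map (a ℕ.+_) (cuts (b ∷ as))

firstPart : List ℕ → ℕ
firstPart []      = 0
firstPart (a ∷ _) = a

-- for 1 ≤ x ≤ n, the index i with p_{i-1} < x ≤ p_i
idx : List ℕ → ℕ → ℕ
idx []       x = 0
idx (a ∷ as) x = if x ≤ᵇ a then 1 else suc (idx as (x ∸ a))

negLabel : Bool → ℕ → ℤ
negLabel false (suc zero) = + 1     -- join: blocks ±1 are merged
negLabel _     m          = - (+ m)

blockLabel : ∀ {n} → TypeBComp n → ℤ → ℤ
blockLabel α (+ zero)    = 0ℤ
blockLabel α (+ (suc k)) = + idx (parts α) (suc k)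
blockLabel α -[1+ k ]    = negLabel (split α) (idx (parts α) (suc k))

-- Parabolic quotient 𝔥_α: π with ℓ(πs) > ℓ(π), i.e. s ∉ Inv(π),
-- for every simple generator s ∉ J_α.
-- s₀ = ⟦ 1 ⟧, s_i = ⦅ i , i+1 ⦆.

InHα : ∀ {n} → TypeBComp n → List ℤ → Set
InHα {n} α π =
  IsSPerm n π
  × (split α ≡ false → ¬ Inv π ⟦ 1 ⟧)
  × (∀ i → 1 ℕ.≤ i → i ℕ.< n → ¬ (i ∈ cuts (parts α)) → ¬ Inv π ⦅ i , suc i ⦆)

_⁺ : ℤ → ℤ
-[1+ zero ] ⁺ = + 1
x ⁺           = x ℤ.+ 1ℤ

BaseTriple : ∀ {n} → TypeBComp n → List ℤ → ℤ → ℤ → ℤ → Set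
BaseTriple {n} α π i j k =
  InPM n i × InPM n j × InPM n k
  × (i ℤ.< j) × (j ℤ.< k)
  × (blockLabel α i ≢ blockLabel α j)
  × (blockLabel α i ≢ blockLabel α k)
  × (blockLabel α j ≢ blockLabel α k)
  × (0ℤ ℤ.< j)
  × (ap π i ≡ (ap π k) ⁺)

SplitPattern : ∀ {n} → TypeBComp n → List ℤ → ℤ → ℤ → ℤ → Set
SplitPattern α π i j k = BaseTriple α π i j k × (ap π i ℤ.< ap π j)

JoinPattern : ∀ {n} → TypeBComp n → List ℤ → ℤ → ℤ → ℤ → Set
JoinPattern α π i j k =
  BaseTriple α π i j k
  × (  ((+ firstPart (parts α) ℤ.< j) × (ap π i ℤ.< ap π j))
     ⊎ ((j ℤ.≤ + firstPart (parts α)) × (ap π j ℤ.< ap π k)))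

Pattern231 : ∀ {n} → TypeBComp n → List ℤ → ℤ → ℤ → ℤ → Set
Pattern231 α π i j k =
  if split α then SplitPattern α π i j k else JoinPattern α π i j k

InTam : ∀ {n} → TypeBComp n → List ℤ → Set
InTam α π = InHα α π × (¬ (∃ λ i → ∃ λ j → ∃ λ k → Pattern231 α π i j k))

module _ (P : List ℤ → Set) (_≤_ : List ℤ → List ℤ → Set) where

  IsMeet : List ℤ → List ℤ → List ℤ → Set
  IsMeet x y m = P m × (m ≤ x) × (m ≤ y)
                 × (∀ z → P z → z ≤ x → z ≤ y → z ≤ m)

  IsJoin : List ℤ → List ℤ → List ℤ → Set
  IsJoin x y m = P m × (x ≤ m) × (y ≤ m)
                 × (∀ z → P z → x ≤ z → y ≤ z → m ≤ z)

  IsLattice : Set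
  IsLattice = ∀ x y → P x → P y → (∃ λ m → IsMeet x y m) × (∃ λ j → IsJoin x y j)

  IsLatticeCongruence : (List ℤ → List ℤ → Set) → Set
  IsLatticeCongruence Θ =
    (∀ x → P x → Θ x x)
    × (∀ x y → P x → P y → Θ x y → Θ y x)
    × (∀ x y z → P x → P y → P z → Θ x y → Θ y z → Θ x z)
    × (∀ x y z m m′ → P x → P y → P z → Θ x y
         → IsMeet x z m → IsMeet y z m′ → Θ m m′)
    × (∀ x y z m m′ → P x → P y → P z → Θ x y
         → IsJoin x z m → IsJoin y z m′ → Θ m m′)

  -- the quotient lattice (P, ≤)/Θ is isomorphic to (Q, ≤) via x/Θ ↦ f x.
  -- In the quotient, x/Θ ≤ y/Θ iff (x ∧ y) Θ x.
  QuotientIso : (List ℤ → List ℤ → Set) → (List ℤ → Set) → (List ℤ → List ℤ) → Set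
  QuotientIso Θ Q f =
    (∀ x → P x → Q (f x))
    × (∀ y → Q y → ∃ λ x → P x × (f x ≡ y))
    × (∀ x y → P x → P y → ((f x ≡ f y) ⇔ Θ x y))
    × (∀ x y m → P x → P y → IsMeet x y m → (Θ m x ⇔ (f x ≤ f y)))

{-# OPTIONS --safe #-}

-- For positions i < k in different blocks there is exactly one way to place the positions
-- between i and k above or below (`col`) so that a descent from i to k is in no 231-pattern;
-- call this the arc from i to k. It yields a set of pairs that must be inverted
-- for x to lie above the join-irreducible of the arc (`Above x i k`), and a set of pairs
-- that must not be inverted for x to lie below its meet-irreducible (`Under x i k`).
-- Arcs restrict to arcs, so Above x satisfies the cotransitivity condition under which
-- its transitive closure is the inversion set of a signed permutation `proj x`; this is the
-- largest pattern-avoiding element below x, and the congruence is: x and y lie above the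
-- same join-irreducibles. Meets are compatible because proj is monotone. For joins,
-- containment of the Above-relations is equivalent to reverse containment of the
-- Under-relations, and Under (x ∨ z) is the intersection of Under x and Under z.
module Submission where

open import Defs
open import Algebra.Properties.CommutativeSemigroup using (x∙yz≈y∙xz)
open import Data.Bool as Bool using (Bool; true; false; not; if_then_else_)
open import Data.Bool.Properties using (not-involutive) renaming (_≟_ to _≟ᵇ_)
open import Data.Empty using (⊥)
open import Data.Fin using (Fin; zero; suc; toℕ; fromℕ<)
open import Data.Fin.Properties as FinP using (toℕ<n; toℕ-injective; toℕ-fromℕ<; all?; any?)
open import Data.Integer as ℤ using (ℤ; +_; -[1+_]; -_; ∣_∣; 0ℤ; 1ℤ; _⊖_)
open import Data.Integer.Properties as ℤP using ()
open import Data.List using (List; []; _∷_; map; length; tabulate)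
open import Data.List.Membership.Propositional using (_∈_)
open import Data.List.Membership.Propositional.Properties using (∈-map⁻)
open import Data.List.Properties using (length-tabulate; map-tabulate; tabulate-cong; length-map; map-cong; map-∘)
open import Data.List.Relation.Unary.All as All using (All; []; _∷_)
open import Data.List.Relation.Unary.All.Properties as AllP using ()
open import Data.List.Relation.Unary.AllPairs using ([]; _∷_)
open import Data.List.Relation.Unary.Any using (here; there)
open import Data.List.Relation.Unary.Unique.Propositional using (Unique)
open import Data.List.Relation.Unary.Unique.Propositional.Properties as UniqueP using ()
open import Data.Nat as ℕ using (ℕ; _≤_; zero; suc; z≤n; s≤s)
open import Data.Nat.ListAction using (sum)
open import Data.Nat.Properties as ℕP using ()
open import Data.Product using (Σ; ∃; _×_; _,_; proj₁; proj₂)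
open import Data.Sum as Sum using (_⊎_; inj₁; inj₂)
open import Data.Unit using (tt)
open import Function using (_∘_; mk⇔)
open import Relation.Binary.Construct.Closure.Transitive using (TransClosure; [_]; _∷_; _∷ʳ_; _++_)
open import Relation.Binary.Definitions using (tri<; tri≈; tri>)
open import Relation.Binary.PropositionalEquality using (_≡_; _≢_; refl; sym; trans; cong; cong₂; subst; subst₂)
open import Relation.Nullary using (¬_; Dec; yes; no; contradiction)
open import Relation.Nullary.Decidable using (map′; ¬?; _×-dec_; _⊎-dec_; _→-dec_)

private variable
  n : ℕ

-- Positions

data Pos (n : ℕ) : Set where
  pos neg : Fin n → Pos n

val : Pos n → ℤ
val (pos i) = + suc (toℕ i)
val (neg i) = -[1+ toℕ i ]

opp : Pos n → Pos n
opp (pos i) = neg i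
opp (neg i) = pos i

opp-involutive : (p : Pos n) → opp (opp p) ≡ p
opp-involutive (pos i) = refl
opp-involutive (neg i) = refl

val-opp : (p : Pos n) → val (opp p) ≡ - val p
val-opp (pos i) = refl
val-opp (neg i) = refl

val-injective : {p q : Pos n} → val p ≡ val q → p ≡ q
val-injective {p = pos i} {pos j} eq = cong pos (toℕ-injective (ℕP.suc-injective (ℤP.+-injective eq)))
val-injective {p = neg i} {neg j} eq = cong neg (toℕ-injective (ℤP.-[1+-injective eq))

position : ∀ x → InPM n x → ∃ λ (p : Pos n) → val p ≡ x
position (+ zero)  (x≢0 , _)  = contradiction refl x≢0
position (+ suc k) (_ , k<n)  = pos (fromℕ< k<n) , cong (+_ ∘ suc) (toℕ-fromℕ< k<n)
position -[1+ k ]  (_ , k<n)  = neg (fromℕ< k<n) , cong -[1+_] (toℕ-fromℕ< k<n)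

val-InPM : (p : Pos n) → InPM n (val p)
val-InPM (pos i) = (λ ()) , toℕ<n i
val-InPM (neg i) = (λ ()) , toℕ<n i

infix 4 _◁_ _⊴_

-- Records rather than synonyms, so that the two positions can be inferred from the type although
-- `val` hides them.
record _◁_ (p q : Pos n) : Set where
  constructor ⟨_⟩
  field lt : val p ℤ.< val q
open _◁_

record _⊴_ (p q : Pos n) : Set where
  constructor ⟨_⟩
  field le : val p ℤ.≤ val q
open _⊴_

⊴-refl : {p : Pos n} → p ⊴ p
⊴-refl = ⟨ ℤP.≤-refl ⟩

◁⇒⊴ : {p q : Pos n} → p ◁ q → p ⊴ q
◁⇒⊴ ⟨ p<q ⟩ = ⟨ ℤP.<⇒≤ p<q ⟩

⊴-trans : {p q r : Pos n} → p ⊴ q → q ⊴ r → p ⊴ r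
⊴-trans ⟨ p≤q ⟩ ⟨ q≤r ⟩ = ⟨ ℤP.≤-trans p≤q q≤r ⟩

◁-trans : {p q r : Pos n} → p ◁ q → q ◁ r → p ◁ r
◁-trans ⟨ p<q ⟩ ⟨ q<r ⟩ = ⟨ ℤP.<-trans p<q q<r ⟩

◁-⊴-trans : {p q r : Pos n} → p ◁ q → q ⊴ r → p ◁ r
◁-⊴-trans ⟨ p<q ⟩ ⟨ q≤r ⟩ = ⟨ ℤP.<-≤-trans p<q q≤r ⟩

⊴-◁-trans : {p q r : Pos n} → p ⊴ q → q ◁ r → p ◁ r
⊴-◁-trans ⟨ p≤q ⟩ ⟨ q<r ⟩ = ⟨ ℤP.≤-<-trans p≤q q<r ⟩

◁-irrefl : {p : Pos n} → ¬ p ◁ p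
◁-irrefl ⟨ p<p ⟩ = ℤP.<-irrefl refl p<p

⊴⇒≡⊎◁ : {p q : Pos n} → p ⊴ q → p ≡ q ⊎ p ◁ q
⊴⇒≡⊎◁ {p = p} {q} ⟨ p≤q ⟩ with val p ℤP.≟ val q
... | yes eq = inj₁ (val-injective eq)
... | no neq = inj₂ ⟨ ℤP.≤∧≢⇒< p≤q neq ⟩

data Order (p q : Pos n) : Set where
  before : p ◁ q → Order p q
  same   : p ≡ q → Order p q
  after  : q ◁ p → Order p q

order : (p q : Pos n) → Order p q
order p q with ℤP.<-cmp (val p) (val q)
... | tri< p<q _ _ = before ⟨ p<q ⟩
... | tri≈ _ p≡q _ = same (val-injective p≡q)
... | tri> _ _ q<p = after ⟨ q<p ⟩

_◁?_ : (p q : Pos n) → Dec (p ◁ q)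
p ◁? q = map′ ⟨_⟩ lt (val p ℤP.<? val q)

_⊴?_ : (p q : Pos n) → Dec (p ⊴ q)
p ⊴? q = map′ ⟨_⟩ le (val p ℤP.≤? val q)

_≟ᵖ_ : (p q : Pos n) → Dec (p ≡ q)
p ≟ᵖ q = map′ val-injective (cong val) (val p ℤP.≟ val q)

opp-◁ : {p q : Pos n} → p ◁ q → opp q ◁ opp p
opp-◁ {p = p} {q} ⟨ p<q ⟩ =
  ⟨ subst₂ ℤ._<_ (sym (val-opp q)) (sym (val-opp p)) (ℤP.neg-mono-< p<q) ⟩

opp-⊴ : {p q : Pos n} → p ⊴ q → opp q ⊴ opp p
opp-⊴ {p = p} {q} ⟨ p≤q ⟩ =
  ⟨ subst₂ ℤ._≤_ (sym (val-opp q)) (sym (val-opp p)) (ℤP.neg-mono-≤ p≤q) ⟩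

∀Pos? : {P : Pos n → Set} → (∀ p → Dec (P p)) → Dec (∀ p → P p)
∀Pos? P? = map′ (λ { (f , g) (pos i) → f i ; (f , g) (neg i) → g i })
                (λ h → (h ∘ pos) , (h ∘ neg))
                (all? (P? ∘ pos) ×-dec all? (P? ∘ neg))

∃Pos? : {P : Pos n → Set} → (∀ p → Dec (P p)) → Dec (∃ P)
∃Pos? P? = map′ (λ { (inj₁ (i , h)) → pos i , h ; (inj₂ (i , h)) → neg i , h })
                (λ { (pos i , h) → inj₁ (i , h) ; (neg i , h) → inj₂ (i , h) })
                (any? (P? ∘ pos) ⊎-dec any? (P? ∘ neg))

-- Induction on intervals of positions

<suc⇒≤ : ∀ {i j} → i ℤ.< 1ℤ ℤ.+ j → i ℤ.≤ j
<suc⇒≤ {i} {j} i<1+j = subst (i ℤ.≤_) (ℤP.pred-suc j) (ℤP.i<j⇒i≤pred[j] i<1+j)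

-- Induction on the distance of the values: cutting at `r` leaves two strictly shorter intervals. In
-- `go`, `d` is only an upper bound of the distance.
interval-induction : (P : Pos n → Pos n → Set) →
  (∀ {p q} → p ◁ q →
     (∀ {r} → p ◁ r → r ◁ q → P p r) →
     (∀ {r} → p ◁ r → r ◁ q → P r q) → P p q) →
  ∀ {p q} → p ◁ q → P p q
interval-induction P step {p₀} {q₀} p₀◁q₀ = go ∣ val q₀ ℤ.- val p₀ ∣ initial p₀◁q₀
  where
  open ℤP.≤-Reasoning
  sucʳ : ∀ x d → x ℤ.+ + suc d ≡ 1ℤ ℤ.+ (x ℤ.+ + d)
  sucʳ x d = x∙yz≈y∙xz ℤP.+-commutativeSemigroup x 1ℤ (+ d)
  i≤+∣i∣ : ∀ i → i ℤ.≤ + ∣ i ∣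
  i≤+∣i∣ (+ _)    = ℤP.≤-refl
  i≤+∣i∣ -[1+ _ ] = ℤ.-≤+
  initial : val q₀ ℤ.≤ val p₀ ℤ.+ + ∣ val q₀ ℤ.- val p₀ ∣
  initial = begin
    val q₀                                 ≡⟨ ℤP.+-identityʳ (val q₀) ⟨
    val q₀ ℤ.+ 0ℤ                          ≡⟨ cong (λ i → val q₀ ℤ.+ i) (ℤP.+-inverseʳ (val p₀)) ⟨
    val q₀ ℤ.+ (val p₀ ℤ.- val p₀)         ≡⟨ x∙yz≈y∙xz ℤP.+-commutativeSemigroup (val q₀) (val p₀) (- val p₀) ⟩
    val p₀ ℤ.+ (val q₀ ℤ.- val p₀)         ≤⟨ ℤP.+-monoʳ-≤ (val p₀) (i≤+∣i∣ (val q₀ ℤ.- val p₀)) ⟩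
    val p₀ ℤ.+ + ∣ val q₀ ℤ.- val p₀ ∣     ∎
  go : ∀ d {p q} → val q ℤ.≤ val p ℤ.+ + d → p ◁ q → P p q
  go zero {p} {q} q≤p+0 ⟨ p<q ⟩ =
    contradiction (subst (val q ℤ.≤_) (ℤP.+-identityʳ (val p)) q≤p+0) (ℤP.<⇒≱ p<q)
  go (suc d) {p} {q} q≤p+d p◁q = step p◁q
    (λ {r} p◁r r◁q → go d (<suc⇒≤ (begin-strict
      val r                        <⟨ lt r◁q ⟩
      val q                        ≤⟨ q≤p+d ⟩
      val p ℤ.+ + suc d            ≡⟨ sucʳ (val p) d ⟩
      1ℤ ℤ.+ (val p ℤ.+ + d)       ∎)) p◁r)
    (λ {r} p◁r r◁q → go d (begin
      val q                        ≤⟨ q≤p+d ⟩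
      val p ℤ.+ + suc d            ≡⟨ sucʳ (val p) d ⟩
      1ℤ ℤ.+ (val p ℤ.+ + d)       ≡⟨ ℤP.+-assoc 1ℤ (val p) (+ d) ⟨
      (1ℤ ℤ.+ val p) ℤ.+ + d       ≤⟨ ℤP.+-monoˡ-≤ (+ d) (ℤP.i<j⇒suc[i]≤j (lt p◁r)) ⟩
      val r ℤ.+ + d                ∎) r◁q)

-- Signed permutations as functions on positions

infix 8 _·_

_·_ : List ℤ → Pos n → ℤ
x · p = ap x (val p)

·-opp : ∀ x (p : Pos n) → x · opp p ≡ - (x · p)
·-opp x (pos i) = refl
·-opp x (neg i) = sym (ℤP.neg-involutive _)

·-opp-< : ∀ x {p q : Pos n} → x · p ℤ.< x · q → x · opp q ℤ.< x · opp p
·-opp-< x {p} {q} p<q = subst₂ ℤ._<_ (sym (·-opp x q)) (sym (·-opp x p)) (ℤP.neg-mono-< p<q)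

nth-tabulate : (f : Fin n → ℤ) (i : Fin n) → nth (tabulate f) (toℕ i) ≡ f i
nth-tabulate f zero    = refl
nth-tabulate f (suc i) = nth-tabulate (f ∘ suc) i

tabulate-nth : ∀ x → length x ≡ n → tabulate {n = n} (λ i → nth x (toℕ i)) ≡ x
tabulate-nth []      refl = refl
tabulate-nth (a ∷ x) refl = cong (a ∷_) (tabulate-nth x refl)

record SignedPerm (n : ℕ) (x : List ℤ) : Set where
  field
    bounded   : (p : Pos n) → InPM n (x · p)
    injective : {p q : Pos n} → x · p ≡ x · q → p ≡ q

  nonzero : (p : Pos n) → x · p ≢ 0ℤ
  nonzero p = proj₁ (bounded p)

  ≮⇒> : {p q : Pos n} → p ≢ q → ¬ x · p ℤ.< x · q → x · q ℤ.< x · p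
  ≮⇒> p≢q p≮q = ℤP.≤∧≢⇒< (ℤP.≮⇒≥ p≮q) (p≢q ∘ injective ∘ sym)

∣∣-≡ : ∀ i j → ∣ i ∣ ≡ ∣ j ∣ → i ≡ j ⊎ i ≡ - j
∣∣-≡ (+ i)       (+ j)       refl = inj₁ refl
∣∣-≡ (+ suc i)   -[1+ j ]    refl = inj₂ refl
∣∣-≡ -[1+ i ]    (+ suc j)   refl = inj₂ refl
∣∣-≡ -[1+ i ]    -[1+ j ]    refl = inj₁ refl

≡neg⇒≡0 : ∀ i → i ≡ - i → i ≡ 0ℤ
≡neg⇒≡0 (+ zero) _ = refl

nth-All : {P : ℤ → Set} → ∀ x → length x ≡ n → All P x → (i : Fin n) → P (nth x (toℕ i))
nth-All (a ∷ x) refl (pa ∷ px) zero    = pa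
nth-All (a ∷ x) refl (pa ∷ px) (suc i) = nth-All x refl px i

nth-Unique : ∀ x → length x ≡ n → Unique (map ∣_∣ x) → {i j : Fin n} →
  ∣ nth x (toℕ i) ∣ ≡ ∣ nth x (toℕ j) ∣ → i ≡ j
nth-Unique (a ∷ x) refl _        {zero}  {zero}  _  = refl
nth-Unique (a ∷ x) refl (h ∷ _)  {zero}  {suc j} eq =
  contradiction eq (nth-All x refl (AllP.map⁻ h) j)
nth-Unique (a ∷ x) refl (h ∷ _)  {suc i} {zero}  eq =
  contradiction (sym eq) (nth-All x refl (AllP.map⁻ h) i)
nth-Unique (a ∷ x) refl (_ ∷ u)  {suc i} {suc j} eq = cong suc (nth-Unique x refl u eq)

IsSPerm⇒SignedPerm : ∀ {x} → IsSPerm n x → SignedPerm n x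
IsSPerm⇒SignedPerm {n = n} {x} (len , inPM , uniq) = record { bounded = bounded ; injective = injective }
  where
  bounded : (p : Pos n) → InPM n (x · p)
  bounded (pos i) = nth-All x len inPM i
  bounded (neg i) with nth-All x len inPM i
  ... | ≢0 , ≤n = (≢0 ∘ ℤP.neg-injective {j = 0ℤ}) , subst (ℕ._≤ n) (sym (ℤP.∣-i∣≡∣i∣ (nth x (toℕ i)))) ≤n
  absurd : ∀ {i j} → nth x (toℕ i) ≢ - nth x (toℕ j)
  absurd {i} {j} eq with nth-Unique x len uniq {i} {j} (trans (cong ∣_∣ eq) (ℤP.∣-i∣≡∣i∣ (nth x (toℕ j))))
  ... | refl = proj₁ (bounded (pos i)) (≡neg⇒≡0 _ eq)
  injective : {p q : Pos n} → x · p ≡ x · q → p ≡ q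
  injective {pos i} {pos j} eq = cong pos (nth-Unique x len uniq (cong ∣_∣ eq))
  injective {pos i} {neg j} eq = contradiction eq (absurd {i} {j})
  injective {neg i} {pos j} eq = contradiction (sym eq) (absurd {j} {i})
  injective {neg i} {neg j} eq = cong neg (nth-Unique x len uniq (cong ∣_∣ (ℤP.neg-injective eq)))

tabulate-IsSPerm : (v : Fin n → ℤ) → (∀ i → InPM n (v i)) →
  (∀ {i j} → ∣ v i ∣ ≡ ∣ v j ∣ → i ≡ j) → IsSPerm n (tabulate v)
tabulate-IsSPerm v inPM inj =
  length-tabulate v , AllP.tabulate⁺ inPM ,
  subst Unique (sym (map-tabulate v ∣_∣)) (UniqueP.tabulate⁺ inj)

module _ {x : List ℤ} (perm : IsSPerm n x) where
  open SignedPerm (IsSPerm⇒SignedPerm perm)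

  -- A missed absolute value would let 1 + n pigeons into n holes.
  surjective : ∀ v → InPM n v → ∃ λ (p : Pos n) → x · p ≡ v
  surjective v (v≢0 , ∣v∣≤n) with ∃Pos? (λ p → x · p ℤP.≟ v)
  ... | yes found = found
  ... | no missed = contradiction (FinP.injective⇒≤ hole-injective) (ℕP.<⇒≱ ℕP.≤-refl)
    where
    missed-abs : ∀ i → ∣ v ∣ ≢ ∣ x · pos i ∣
    missed-abs i eq with ∣∣-≡ v (x · pos i) eq
    ... | inj₁ v≡ = missed (pos i , sym v≡)
    ... | inj₂ v≡ = missed (neg i , sym v≡)
    abs : Fin (suc n) → ℤ
    abs zero    = v
    abs (suc i) = x · pos i
    abs-InPM : ∀ i → InPM n (abs i)
    abs-InPM zero    = v≢0 , ∣v∣≤n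
    abs-InPM (suc i) = bounded (pos i)
    abs-injective : ∀ {i j} → ∣ abs i ∣ ≡ ∣ abs j ∣ → i ≡ j
    abs-injective {zero}  {zero}  _  = refl
    abs-injective {zero}  {suc j} eq = contradiction eq (missed-abs j)
    abs-injective {suc i} {zero}  eq = contradiction (sym eq) (missed-abs i)
    abs-injective {suc i} {suc j} eq =
      cong suc (nth-Unique x (proj₁ perm) (proj₂ (proj₂ perm)) eq)
    hole : ∀ z → InPM n z → Fin n
    hole (+ zero)  (z≢0 , _) = contradiction refl z≢0
    hole (+ suc k) (_ , k<n) = fromℕ< k<n
    hole -[1+ k ]  (_ , k<n) = fromℕ< k<n
    ∣∣≡suc-hole : ∀ z (h : InPM n z) → ∣ z ∣ ≡ suc (toℕ (hole z h))
    ∣∣≡suc-hole (+ zero)  (z≢0 , _) = contradiction refl z≢0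
    ∣∣≡suc-hole (+ suc k) (_ , k<n) = cong suc (sym (toℕ-fromℕ< k<n))
    ∣∣≡suc-hole -[1+ k ]  (_ , k<n) = cong suc (sym (toℕ-fromℕ< k<n))
    hole-injective : ∀ {i j} → hole (abs i) (abs-InPM i) ≡ hole (abs j) (abs-InPM j) → i ≡ j
    hole-injective {i} {j} eq = abs-injective
      (trans (∣∣≡suc-hole (abs i) (abs-InPM i))
        (trans (cong (suc ∘ toℕ) eq) (sym (∣∣≡suc-hole (abs j) (abs-InPM j)))))

⁺-> : ∀ i → i ℤ.< i ⁺
⁺-> (+ i)          = ℤ.+<+ (ℕP.m<m+n i (s≤s z≤n))
⁺-> -[1+ zero ]    = ℤ.-<+
⁺-> -[1+ suc i ]   = ℤ.-<- ℕP.≤-refl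

module _ {y z : List ℤ} (yPerm : IsSPerm n y) (zPerm : IsSPerm n z) where
  private
    module Y = SignedPerm (IsSPerm⇒SignedPerm yPerm)
    module Z = SignedPerm (IsSPerm⇒SignedPerm zPerm)

  module _ (adjacent-< : ∀ (p q : Pos n) → y · q ≡ (y · p) ⁺ → z · p ℤ.< z · q) where
    private
      -- Climbing through the positive values of `y`, `z` grows by at least one at each step.
      -- `upper` descends from the largest value `n` in the same way.
      lower : ∀ m (p : Pos n) → y · p ≡ + suc m → + suc m ℤ.≤ z · p
      -- The value 1 is the successor of -1, so the hypothesis compares `z` at `opp p` and `p`,
      -- which forces `z · p` to be positive.
      lower zero p eq = ℤP.i<j⇒suc[i]≤j (positive (z · p) (subst (ℤ._< z · p) (·-opp z p)
          (adjacent-< (opp p) p (trans eq (cong _⁺ (sym (trans (·-opp y p) (cong -_ eq))))))))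
        where
        positive : ∀ i → - i ℤ.< i → 0ℤ ℤ.< i
        positive (+ suc _) _ = ℤ.+<+ (s≤s z≤n)
        positive (+ zero) (ℤ.+<+ ())
      lower (suc m) p eq
        with surjective yPerm (+ suc m)
               ((λ ()) , ℕP.≤-trans (ℕP.n≤1+n _) (subst (ℕ._≤ n) (cong ∣_∣ eq) (proj₂ (Y.bounded p))))
      ... | q , eq′ = ℤP.i<j⇒suc[i]≤j (ℤP.≤-<-trans (lower m q eq′)
              (adjacent-< q p (trans eq (trans (cong +_ (ℕP.+-comm 1 (suc m))) (cong _⁺ (sym eq′))))))

      upper : ∀ d m (p : Pos n) → d ℕ.+ suc m ≡ n → y · p ≡ + suc m → z · p ℤ.≤ + suc m
      upper zero m p refl eq = ≤+∣∣ (z · p) (proj₂ (Z.bounded p))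
        where
        ≤+∣∣ : ∀ i {k} → ∣ i ∣ ℕ.≤ k → i ℤ.≤ + k
        ≤+∣∣ (+ _)    h = ℤ.+≤+ h
        ≤+∣∣ -[1+ _ ] h = ℤ.-≤+
      upper (suc d) m p refl eq
        with surjective yPerm (+ suc (suc m)) ((λ ()) , s≤s (ℕP.m≤n+m (suc m) d))
      ... | q , eq′ = <suc⇒≤ (ℤP.<-≤-trans
              (adjacent-< p q (trans eq′ (trans (cong +_ (ℕP.+-comm 1 (suc m))) (cong _⁺ (sym eq)))))
              (upper d (suc m) q (ℕP.+-suc d (suc m)) eq′))

      agree⁺ : ∀ (p : Pos n) m → y · p ≡ + suc m → z · p ≡ y · p
      agree⁺ p m eq = trans (ℤP.≤-antisym
          (upper (n ℕ.∸ suc m) m p (ℕP.m∸n+n≡m (subst (ℕ._≤ n) (cong ∣_∣ eq) (proj₂ (Y.bounded p)))) eq)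
          (lower m p eq)) (sym eq)

      agree : (p : Pos n) → z · p ≡ y · p
      agree p with y · p in eq
      ... | + zero   = contradiction eq (Y.nonzero p)
      ... | + suc m  = trans (agree⁺ p m eq) eq
      ... | -[1+ m ] = trans (ℤP.neg-injective (trans (sym (·-opp z p))
                         (trans (agree⁺ (opp p) m (trans (·-opp y p) (cong -_ eq))) (·-opp y p)))) eq

    -- Positive values of `y` are squeezed between `lower` and `upper`, and negative ones follow by
    -- symmetry. Equality of signed permutations is thus reduced to pairs of consecutive values.
    adjacent-monotone⇒≡ : z ≡ y
    adjacent-monotone⇒≡ = trans (sym (tabulate-nth z (proj₁ zPerm)))
      (trans (tabulate-cong (agree ∘ pos)) (tabulate-nth y (proj₁ yPerm)))


-- Signed permutations from inversions

card : {P : Fin n → Set} → (∀ i → Dec (P i)) → ℕ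
card {zero}  P? = 0
card {suc n} P? with P? zero
... | yes _ = suc (card (P? ∘ suc))
... | no _  = card (P? ∘ suc)

card≤n : {P : Fin n → Set} (P? : ∀ i → Dec (P i)) → card P? ℕ.≤ n
card≤n {zero}  P? = z≤n
card≤n {suc n} P? with P? zero
... | yes _ = s≤s (card≤n (P? ∘ suc))
... | no _  = ℕP.m≤n⇒m≤1+n (card≤n (P? ∘ suc))

card-mono : {P Q : Fin n → Set} (P? : ∀ i → Dec (P i)) (Q? : ∀ i → Dec (Q i)) →
  (∀ i → P i → Q i) → card P? ℕ.≤ card Q?
card-mono {zero}  P? Q? P⇒Q = z≤n
card-mono {suc n} P? Q? P⇒Q with P? zero | Q? zero
... | yes p | yes q = s≤s (card-mono (P? ∘ suc) (Q? ∘ suc) (P⇒Q ∘ suc))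
... | yes p | no ¬q = contradiction (P⇒Q zero p) ¬q
... | no ¬p | yes q = ℕP.m≤n⇒m≤1+n (card-mono (P? ∘ suc) (Q? ∘ suc) (P⇒Q ∘ suc))
... | no ¬p | no ¬q = card-mono (P? ∘ suc) (Q? ∘ suc) (P⇒Q ∘ suc)

card-strict : {P Q : Fin n → Set} (P? : ∀ i → Dec (P i)) (Q? : ∀ i → Dec (Q i)) →
  (∀ i → P i → Q i) → ∀ i → ¬ P i → Q i → card P? ℕ.< card Q?
card-strict {suc n} P? Q? P⇒Q zero ¬p q with P? zero | Q? zero
... | yes p | _     = contradiction p ¬p
... | no _  | yes _ = s≤s (card-mono (P? ∘ suc) (Q? ∘ suc) (P⇒Q ∘ suc))
... | no _  | no ¬q = contradiction q ¬q
card-strict {suc n} P? Q? P⇒Q (suc i) ¬p q with P? zero | Q? zero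
... | yes p | yes _ = s≤s (card-strict (P? ∘ suc) (Q? ∘ suc) (P⇒Q ∘ suc) i ¬p q)
... | yes p | no ¬q = contradiction (P⇒Q zero p) ¬q
... | no _  | yes _ = ℕP.m≤n⇒m≤1+n (card-strict (P? ∘ suc) (Q? ∘ suc) (P⇒Q ∘ suc) i ¬p q)
... | no _  | no _  = card-strict (P? ∘ suc) (Q? ∘ suc) (P⇒Q ∘ suc) i ¬p q

-- The conditions on a set of pairs under which its transitive closure is the
-- inversion set of a signed permutation.
record Generator (n : ℕ) (E : Pos n → Pos n → Set) : Set where
  field
    E?      : ∀ p q → Dec (E p q)
    E⇒◁     : ∀ {p q} → E p q → p ◁ q
    E-opp   : ∀ {p q} → E p q → E (opp q) (opp p)
    E-split : ∀ {p q r} → E p r → p ◁ q → q ◁ r → E p q ⊎ E q r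

module Generated {n} {E : Pos n → Pos n → Set} (gen : Generator n E) where
  open Generator gen

  T : Pos n → Pos n → Set
  T = TransClosure E

  T⇒◁ : ∀ {p q} → T p q → p ◁ q
  T⇒◁ [ e ]   = E⇒◁ e
  T⇒◁ (e ∷ t) = ◁-trans (E⇒◁ e) (T⇒◁ t)

  T-opp : ∀ {p q} → T p q → T (opp q) (opp p)
  T-opp [ e ]   = [ E-opp e ]
  T-opp (e ∷ t) = T-opp t ∷ʳ E-opp e

  -- Some link of the chain ends at `q` or jumps over it. In the second case `E-split` cuts that
  -- link.
  T-split : ∀ {p q r} → T p r → p ◁ q → q ◁ r → T p q ⊎ T q r
  T-split [ e ] p◁q q◁r = Sum.map [_] [_] (E-split e p◁q q◁r)
  T-split {q = q} (_∷_ {y = s} e t) p◁q q◁r with order q s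
  ... | before q◁s = Sum.map [_] (_∷ t) (E-split e p◁q q◁s)
  ... | same refl  = inj₁ [ e ]
  ... | after s◁q  = Sum.map (e ∷_) (λ t′ → t′) (T-split t s◁q q◁r)

  opaque
    -- After its first link a chain runs inside a shorter interval, so interval induction leaves a
    -- finite search for the end of that link.
    T? : ∀ p q → Dec (T p q)
    T? p q with p ◁? q
    ... | no p⋪q  = no (p⋪q ∘ T⇒◁)
    ... | yes p◁q = interval-induction (λ p q → Dec (T p q)) step p◁q
      where
      step : ∀ {p q} → p ◁ q → (∀ {r} → p ◁ r → r ◁ q → Dec (T p r)) →
             (∀ {r} → p ◁ r → r ◁ q → Dec (T r q)) → Dec (T p q)
      step {p} {q} _ _ rec =
        map′ (λ { (inj₁ e) → [ e ] ; (inj₂ (_ , e , t)) → e ∷ t })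
             (λ { [ e ] → inj₁ e ; (e ∷ t) → inj₂ (_ , e , t) })
             (E? p q ⊎-dec ∃Pos? via)
        where
        via : ∀ r → Dec (E p r × T r q)
        via r with E? p r | r ◁? q
        ... | no ¬e | _       = no (¬e ∘ proj₁)
        ... | yes _ | no r⋪q  = no (r⋪q ∘ T⇒◁ ∘ proj₂)
        ... | yes e | yes r◁q = map′ (e ,_) proj₂ (rec (E⇒◁ e) r◁q)

  infix 4 _⊏_ _⊑_

  -- The intended order of the values: natural, except on the pairs in `T`, where it is reversed.
  _⊏_ : Pos n → Pos n → Set
  p ⊏ q = (p ◁ q × ¬ T p q) ⊎ T q p

  _⊑_ : Pos n → Pos n → Set
  p ⊑ q = p ≡ q ⊎ p ⊏ q

  _⊑?_ : ∀ p q → Dec (p ⊑ q)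
  p ⊑? q = (p ≟ᵖ q) ⊎-dec ((p ◁? q) ×-dec ¬? (T? p q)) ⊎-dec T? q p

  ⊏-irrefl : ∀ {p} → ¬ p ⊏ p
  ⊏-irrefl (inj₁ (p◁p , _)) = ◁-irrefl p◁p
  ⊏-irrefl (inj₂ t)         = ◁-irrefl (T⇒◁ t)

  -- Both `T` and its complement in `_◁_` are transitive, the complement by `T-split`. This is the
  -- usual characterisation of inversion sets.
  ⊏-trans : ∀ {p q r} → p ⊏ q → q ⊏ r → p ⊏ r
  ⊏-trans (inj₁ (p◁q , ¬pq)) (inj₁ (q◁r , ¬qr)) =
    inj₁ (◁-trans p◁q q◁r , λ pr → Sum.[ ¬pq , ¬qr ] (T-split pr p◁q q◁r))
  ⊏-trans {p} {q} {r} (inj₁ (p◁q , ¬pq)) (inj₂ rq) with order p r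
  ... | before p◁r = inj₁ (p◁r , λ pr → ¬pq (pr ++ rq))
  ... | same refl  = contradiction rq ¬pq
  ... | after r◁p  = inj₂ (Sum.[ (λ rp → rp) , (λ pq → contradiction pq ¬pq) ] (T-split rq r◁p p◁q))
  ⊏-trans {p} {q} {r} (inj₂ qp) (inj₁ (q◁r , ¬qr)) with order p r
  ... | before p◁r = inj₁ (p◁r , λ pr → ¬qr (qp ++ pr))
  ... | same refl  = contradiction qp ¬qr
  ... | after r◁p  = inj₂ (Sum.[ (λ qr → contradiction qr ¬qr) , (λ rp → rp) ] (T-split qp q◁r r◁p))
  ⊏-trans (inj₂ qp) (inj₂ rq) = inj₂ (rq ++ qp)

  ⊑-⊏-trans : ∀ {p q r} → p ⊑ q → q ⊏ r → p ⊏ r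
  ⊑-⊏-trans (inj₁ refl) q⊏r = q⊏r
  ⊑-⊏-trans (inj₂ p⊏q)  q⊏r = ⊏-trans p⊏q q⊏r

  ⊏-total : ∀ p q → p ≢ q → p ⊏ q ⊎ q ⊏ p
  ⊏-total p q p≢q with order p q
  ... | same p≡q   = contradiction p≡q p≢q
  ... | before p◁q with T? p q
  ...   | yes pq = inj₂ (inj₂ pq)
  ...   | no ¬pq = inj₁ (inj₁ (p◁q , ¬pq))
  ⊏-total p q p≢q | after q◁p with T? q p
  ...   | yes qp = inj₁ (inj₂ qp)
  ...   | no ¬qp = inj₂ (inj₁ (q◁p , ¬qp))

  T-opp⁻ : ∀ {p q} → T (opp q) (opp p) → T p q
  T-opp⁻ {p} {q} t = subst₂ T (opp-involutive p) (opp-involutive q) (T-opp t)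

  ⊏-opp : ∀ {p q} → p ⊏ q → opp q ⊏ opp p
  ⊏-opp (inj₁ (p◁q , ¬pq)) = inj₁ (opp-◁ p◁q , ¬pq ∘ T-opp⁻)
  ⊏-opp (inj₂ qp)          = inj₂ (T-opp qp)

  p≢opp : ∀ (p : Pos n) → p ≢ opp p
  p≢opp (pos i) ()
  p≢opp (neg i) ()

  -- For `p` above its opposite, these are the `i` whose absolute value is at most that of `p`, so
  -- their number is the value at `p`. For `p` below its opposite there are none.
  Below : Pos n → Fin n → Set
  Below p i = pos i ⊑ p × neg i ⊑ p

  below? : ∀ p i → Dec (Below p i)
  below? p i = (pos i ⊑? p) ×-dec (neg i ⊑? p)

  below-mono : ∀ {p q} → p ⊏ q → ∀ i → Below p i → Below q i
  below-mono p⊏q i (a , b) = inj₂ (⊑-⊏-trans a p⊏q) , inj₂ (⊑-⊏-trans b p⊏q)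

  opaque
    count : Pos n → ℕ
    count p = card (below? p)

    count≤n : ∀ p → count p ℕ.≤ n
    count≤n p = card≤n (below? p)

    count-mono : ∀ {p q} → p ⊏ q → count p ℕ.≤ count q
    count-mono {p} {q} p⊏q = card-mono (below? p) (below? q) (below-mono p⊏q)

    -- The index underlying `q` is counted for `q`, which lies above its opposite, but not for the
    -- smaller `p`.
    count-strict : ∀ {p q} → opp q ⊏ q → p ⊏ q → count p ℕ.< count q
    count-strict {p} {pos i} q⁻⊏q p⊏q = card-strict (below? p) (below? (pos i)) (below-mono p⊏q) i
      (λ { (a , _) → ⊏-irrefl (⊑-⊏-trans a p⊏q) }) (inj₁ refl , inj₂ q⁻⊏q)
    count-strict {p} {neg i} q⁻⊏q p⊏q = card-strict (below? p) (below? (neg i)) (below-mono p⊏q) i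
      (λ { (_ , b) → ⊏-irrefl (⊑-⊏-trans b p⊏q) }) (inj₂ q⁻⊏q , inj₁ refl)

  -- At most one of the two counts is nonzero: count p is the value at p if this is
  -- positive, and count (opp p) is its opposite if it is negative.
  value : Pos n → ℤ
  value p = count p ⊖ count (opp p)

  -- If `q` is above its opposite, the first count grows strictly. Otherwise `p` is below its own
  -- opposite, and the second count shrinks strictly.
  value-mono : ∀ {p q} → p ⊏ q → value p ℤ.< value q
  value-mono {p} {q} p⊏q with ⊏-total (opp q) q (p≢opp q ∘ sym)
  ... | inj₁ q⁻⊏q = ℤP.<-≤-trans (ℤP.⊖-monoˡ-< (count (opp p)) (count-strict q⁻⊏q p⊏q))
                                 (ℤP.⊖-monoʳ-≥-≤ (count q) (count-mono (⊏-opp p⊏q)))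
  ... | inj₂ q⊏q⁻ = ℤP.≤-<-trans (ℤP.⊖-monoˡ-≤ (count (opp p)) (count-mono p⊏q))
                                 (ℤP.⊖-monoʳ->-< (count q) (count-strict p⁻⁻⊏p⁻ (⊏-opp p⊏q)))
    where
    p⁻⁻⊏p⁻ : opp (opp p) ⊏ opp p
    p⁻⁻⊏p⁻ = subst (_⊏ opp p) (sym (opp-involutive p))
               (⊏-trans p⊏q (⊏-trans q⊏q⁻ (⊏-opp p⊏q)))

  value-injective : ∀ {p q} → value p ≡ value q → p ≡ q
  value-injective {p} {q} eq with p ≟ᵖ q
  ... | yes p≡q = p≡q
  ... | no p≢q with ⊏-total p q p≢q
  ...   | inj₁ p⊏q = contradiction (value-mono p⊏q) (ℤP.<-irrefl eq)
  ...   | inj₂ q⊏p = contradiction (value-mono q⊏p) (ℤP.<-irrefl (sym eq))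

  value-opp : ∀ p → value (opp p) ≡ - value p
  value-opp p rewrite opp-involutive p = ℤP.⊖-swap (count (opp p)) (count p)

  value-InPM : ∀ p → InPM n (value p)
  -- A zero value would be shared by `p` and `opp p`.
  value-InPM p = (λ eq → p≢opp p (value-injective (trans eq (sym (trans (value-opp p) (cong -_ eq)))))) ,
    ℕP.≤-trans (ℤP.∣m⊝n∣≤m⊔n (count p) (count (opp p)))
               (ℕP.⊔-lub (count≤n p) (count≤n (opp p)))

  opaque
    generated : List ℤ
    generated = tabulate (value ∘ pos)

    generated-IsSPerm : IsSPerm n generated
    generated-IsSPerm = tabulate-IsSPerm (value ∘ pos) (value-InPM ∘ pos) ∣value∣-injective
      where
      ∣value∣-injective : ∀ {i j} → ∣ value (pos i) ∣ ≡ ∣ value (pos j) ∣ → i ≡ j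
      ∣value∣-injective {i} {j} eq with ∣∣-≡ (value (pos i)) (value (pos j)) eq
      ... | inj₁ equal with value-injective equal
      ...   | refl = refl
      ∣value∣-injective {i} {j} eq | inj₂ opposite
        with value-injective {q = neg j} (trans opposite (sym (value-opp (pos j))))
      ...   | ()

    generated-value : ∀ p → generated · p ≡ value p
    generated-value (pos i) = nth-tabulate (value ∘ pos) i
    generated-value (neg i) = trans (cong -_ (nth-tabulate (value ∘ pos) i)) (sym (value-opp (pos i)))

    ⊏⇒< : ∀ {p q} → p ⊏ q → generated · p ℤ.< generated · q
    ⊏⇒< {p} {q} p⊏q = subst₂ ℤ._<_ (sym (generated-value p)) (sym (generated-value q)) (value-mono p⊏q)

    T⇒inversion : ∀ {p q} → T p q → generated · q ℤ.< generated · p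
    T⇒inversion t = ⊏⇒< (inj₂ t)

    inversion⇒T : ∀ {p q} → p ◁ q → generated · q ℤ.< generated · p → T p q
    inversion⇒T {p} {q} p◁q q<p with T? p q
    ... | yes t = t
    ... | no ¬t = contradiction q<p (ℤP.<-asym (⊏⇒< (inj₁ (p◁q , ¬t))))

-- The weak order

-- Inclusion of inversion sets on pairs of positions. A reflection amounts to such a pair together
-- with its opposite, and `⟦ i ⟧` to the self-opposite pair of `-i` and `i`.
record Weak (n : ℕ) (x z : List ℤ) : Set where
  constructor weak
  field inv-⊆ : ∀ {p q : Pos n} → p ◁ q → x · q ℤ.< x · p → z · q ℤ.< z · p
open Weak

low high : Refl → ℤ
low ⟦ i ⟧       = - (+ i)
low ⦅ i , j ⦆   = + i
low ⦅- j , i ⦆  = - (+ j)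
high ⟦ i ⟧      = + i
high ⦅ i , j ⦆  = + j
high ⦅- j , i ⦆ = + i

<neg⇒<0 : ∀ i → i ℤ.< - i → i ℤ.< 0ℤ
<neg⇒<0 (+ zero) (ℤ.+<+ ())
<neg⇒<0 -[1+ _ ] _ = ℤ.-<+

<0⇒<neg : ∀ i → i ℤ.< 0ℤ → i ℤ.< - i
<0⇒<neg (+ _)    (ℤ.+<+ ())
<0⇒<neg -[1+ _ ] _ = ℤ.-<+

ap-neg : ∀ x i → ap x (- i) ≡ - ap x i
ap-neg x (+ zero)  = refl
ap-neg x (+ suc _) = refl
ap-neg x -[1+ _ ]  = sym (ℤP.neg-involutive _)

Inv⇒ : ∀ x t → Inv x t → ap x (high t) ℤ.< ap x (low t)
Inv⇒ x ⟦ i ⟧       inv rewrite ap-neg x (+ i) = <0⇒<neg _ inv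
Inv⇒ x ⦅ i , j ⦆   inv = inv
Inv⇒ x ⦅- j , i ⦆  inv = inv

Inv⇐ : ∀ x t → ap x (high t) ℤ.< ap x (low t) → Inv x t
Inv⇐ x ⟦ i ⟧       inv rewrite ap-neg x (+ i) = <neg⇒<0 _ inv
Inv⇐ x ⦅ i , j ⦆   inv = inv
Inv⇐ x ⦅- j , i ⦆  inv = inv

record Ends (n : ℕ) (t : Refl) : Set where
  field
    lo hi  : Pos n
    val-lo : val lo ≡ low t
    val-hi : val hi ≡ high t
    lo◁hi  : lo ◁ hi

  Inv⇒ends : ∀ x → Inv x t → x · hi ℤ.< x · lo
  Inv⇒ends x inv rewrite val-lo | val-hi = Inv⇒ x t inv

  ends⇒Inv : ∀ x → x · hi ℤ.< x · lo → Inv x t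
  ends⇒Inv x inv rewrite val-lo | val-hi = Inv⇐ x t inv

ends-from : ∀ {t} → InPM n (low t) → InPM n (high t) → low t ℤ.< high t → Ends n t
ends-from {t = t} lowPM highPM low<high
  with lo , val-lo ← position (low t) lowPM
  with hi , val-hi ← position (high t) highPM = record
  { lo = lo ; hi = hi ; val-lo = val-lo ; val-hi = val-hi
  ; lo◁hi = ⟨ subst₂ ℤ._<_ (sym val-lo) (sym val-hi) low<high ⟩ }

ends : ∀ t → ValidRefl n t → Ends n t
ends ⟦ suc i ⟧           (_ , i≤n)              = ends-from ((λ ()) , i≤n) ((λ ()) , i≤n) ℤ.-<+
ends ⦅ suc i , suc j ⦆   (_ , i<j , j≤n)        =
  ends-from ((λ ()) , ℕP.≤-trans (ℕP.<⇒≤ i<j) j≤n) ((λ ()) , j≤n) (ℤ.+<+ i<j)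
ends ⦅- suc j , suc i ⦆  (_ , i<j , j≤n)        =
  ends-from ((λ ()) , j≤n) ((λ ()) , ℕP.≤-trans (ℕP.<⇒≤ i<j) j≤n) ℤ.-<+

Weak⇒≤weak : ∀ {x z} → Weak n x z → x ≤weak[ n ] z
Weak⇒≤weak {x = x} {z} (weak x≤z) t valid inv =
  ends⇒Inv z (x≤z lo◁hi (Inv⇒ends x inv))
  where open Ends (ends t valid)

≤weak⇒Weak : ∀ {x z} → x ≤weak[ n ] z → Weak n x z
≤weak⇒Weak {n = n} {x} {z} x≤z = weak go
  where
  go⁺ : ∀ {i j} → pos i ◁ pos j → x · pos j ℤ.< x · pos i → z · pos j ℤ.< z · pos i
  go⁺ {i} {j} ⟨ ℤ.+<+ i<j ⟩ = x≤z ⦅ suc (toℕ i) , suc (toℕ j) ⦆ (s≤s z≤n , i<j , toℕ<n j)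
  go : ∀ {p q : Pos n} → p ◁ q → x · q ℤ.< x · p → z · q ℤ.< z · p
  go {pos i} {pos j} p◁q inv = go⁺ p◁q inv
  go {neg i} {neg j} p◁q inv = ·-opp-< z {pos i} {pos j} (go⁺ (opp-◁ p◁q) (·-opp-< x {neg j} {neg i} inv))
  -- Reflections list mixed pairs with the larger absolute value on the negative end, so one case
  -- passes to the opposite pair, and equal absolute values give `⟦_⟧`.
  go {neg i} {pos j} p◁q inv with ℕP.<-cmp (toℕ i) (toℕ j)
  ... | tri< i<j _ _ = ·-opp-< z {pos i} {neg j}
          (x≤z ⦅- suc (toℕ j) , suc (toℕ i) ⦆ (s≤s z≤n , s≤s i<j , toℕ<n j) (·-opp-< x {pos j} {neg i} inv))
  ... | tri> _ _ j<i = x≤z ⦅- suc (toℕ i) , suc (toℕ j) ⦆ (s≤s z≤n , s≤s j<i , toℕ<n i) inv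
  ... | tri≈ _ i≡j _ with toℕ-injective i≡j
  ...   | refl = <0⇒<neg _ (x≤z ⟦ suc (toℕ i) ⟧ (s≤s z≤n , toℕ<n i) (<neg⇒<0 _ inv))
  go {pos i} {neg j} ⟨ () ⟩

Weak-trans : ∀ {x y z} → Weak n x y → Weak n y z → Weak n x z
Weak-trans (weak x≤y) (weak y≤z) = weak (λ p◁q inv → y≤z p◁q (x≤y p◁q inv))

module _ {x z : List ℤ} (xPerm : IsSPerm n x) (zPerm : IsSPerm n z) where
  private
    module X = SignedPerm (IsSPerm⇒SignedPerm xPerm)
    module Z = SignedPerm (IsSPerm⇒SignedPerm zPerm)

  noninversion-⊇ : Weak n x z → {p q : Pos n} → p ◁ q → z · p ℤ.< z · q → x · p ℤ.< x · q
  noninversion-⊇ (weak x≤z) {p} {q} p◁q z< =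
    X.≮⇒> {q} {p} (λ { refl → ◁-irrefl p◁q }) (λ x> → ℤP.<-asym z< (x≤z p◁q x>))

  -- Equal inversion sets order all pairs of positions alike, in particular those with consecutive
  -- values.
  Weak-antisym : Weak n x z → Weak n z x → x ≡ z
  Weak-antisym x≤z z≤x = adjacent-monotone⇒≡ zPerm xPerm adjacent
    where
    adjacent : ∀ (p q : Pos n) → z · q ≡ (z · p) ⁺ → x · p ℤ.< x · q
    adjacent p q eq with order p q | subst (z · p ℤ.<_) (sym eq) (⁺-> (z · p))
    ... | before p◁q | z< = noninversion-⊇ x≤z p◁q z<
    ... | same refl  | z< = contradiction z< (ℤP.<-irrefl refl)
    ... | after q◁p  | z< = inv-⊆ z≤x q◁p z<

-- Multiplication by the longest element. It complements inversion sets and so exchanges meets and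
-- joins.
negate : List ℤ → List ℤ
negate = map -_

negate-· : ∀ x (p : Pos n) → negate x · p ≡ - (x · p)
negate-· x (pos i) = nth-negate x (toℕ i)
  where
  nth-negate : ∀ x k → nth (negate x) k ≡ - nth x k
  nth-negate []      k       = refl
  nth-negate (_ ∷ _) zero    = refl
  nth-negate (_ ∷ x) (suc k) = nth-negate x k
negate-· x (neg i) = cong -_ (negate-· x (pos i))

negate-involutive : ∀ x → negate (negate x) ≡ x
negate-involutive []      = refl
negate-involutive (i ∷ x) = cong₂ _∷_ (ℤP.neg-involutive i) (negate-involutive x)

negate-IsSPerm : ∀ {x} → IsSPerm n x → IsSPerm n (negate x)
negate-IsSPerm {n = n} {x} (len , inPM , uniq) =
  trans (length-map -_ x) len ,
  AllP.map⁺ (All.map (λ { {i} (i≢0 , i≤n) →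
    (i≢0 ∘ ℤP.neg-injective {j = 0ℤ}) , subst (ℕ._≤ n) (sym (ℤP.∣-i∣≡∣i∣ i)) i≤n }) inPM) ,
  subst Unique (trans (map-cong (sym ∘ ℤP.∣-i∣≡∣i∣) x) (map-∘ x)) uniq

negate-antitone : ∀ {x z} → IsSPerm n x → IsSPerm n z → Weak n x z → Weak n (negate z) (negate x)
negate-antitone {n = n} {x} {z} xPerm zPerm x≤z = weak (λ {p} {q} p◁q inv →
  subst₂ ℤ._<_ (sym (negate-· x q)) (sym (negate-· x p)) (ℤP.neg-mono-<
    (noninversion-⊇ xPerm zPerm x≤z p◁q
      (ℤP.neg-cancel-< (subst₂ ℤ._<_ (negate-· z q) (negate-· z p) inv)))))

-- Joins and meets in the weak order

JoinInv : ∀ (n : ℕ) → List ℤ → List ℤ → Pos n → Pos n → Set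
JoinInv n x z p q = p ◁ q × (x · q ℤ.< x · p ⊎ z · q ℤ.< z · p)

-- When the outer two positions are inverted, the value in the middle is below the first or above
-- the last. Hence each inversion set satisfies `E-split`, and so does their union.
join-generator : ∀ n x z → Generator n (JoinInv n x z)
join-generator n x z = record
  { E?      = λ p q → (p ◁? q) ×-dec ((x · q ℤP.<? x · p) ⊎-dec (z · q ℤP.<? z · p))
  ; E⇒◁     = proj₁
  ; E-opp   = λ {p} {q} (p◁q , inv) → opp-◁ p◁q , Sum.map (·-opp-< x {q} {p}) (·-opp-< z {q} {p}) inv
  ; E-split = λ { (_ , inj₁ inv) p◁q q◁r → Sum.map (λ h → p◁q , inj₁ h) (λ h → q◁r , inj₁ h) (split-< inv)
                ; (_ , inj₂ inv) p◁q q◁r → Sum.map (λ h → p◁q , inj₂ h) (λ h → q◁r , inj₂ h) (split-< inv) }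
  }
  where
  split-< : ∀ {i j k} → k ℤ.< i → j ℤ.< i ⊎ k ℤ.< j
  split-< {i} {j} k<i with j ℤP.<? i
  ... | yes j<i = inj₁ j<i
  ... | no j≮i  = inj₂ (ℤP.<-≤-trans k<i (ℤP.≮⇒≥ j≮i))

join meet : ℕ → List ℤ → List ℤ → List ℤ
join n x z = Generated.generated (join-generator n x z)
meet n x z = negate (join n (negate x) (negate z))

module _ (n : ℕ) (x z : List ℤ) where
  open Generated (join-generator n x z)

  join-IsSPerm : IsSPerm n (join n x z)
  join-IsSPerm = generated-IsSPerm

  join-upperˡ : Weak n x (join n x z)
  join-upperˡ = weak (λ p◁q inv → T⇒inversion [ p◁q , inj₁ inv ])

  join-upperʳ : Weak n z (join n x z)
  join-upperʳ = weak (λ p◁q inv → T⇒inversion [ p◁q , inj₂ inv ])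

  join-least : ∀ {w} → Weak n x w → Weak n z w → Weak n (join n x z) w
  join-least {w} (weak x≤w) (weak z≤w) = weak (λ p◁q inv → T⇒w (inversion⇒T p◁q inv))
    where
    E⇒w : ∀ {p q} → JoinInv n x z p q → w · q ℤ.< w · p
    E⇒w (p◁q , inv) = Sum.[ x≤w p◁q , z≤w p◁q ] inv
    T⇒w : ∀ {p q} → T p q → w · q ℤ.< w · p
    T⇒w [ e ]   = E⇒w e
    T⇒w (e ∷ t) = ℤP.<-trans (T⇒w t) (E⇒w e)

  join-Inv-chain : ∀ {p q} → p ◁ q → join n x z · q ℤ.< join n x z · p → TransClosure (JoinInv n x z) p q
  join-Inv-chain = inversion⇒T

module _ {x z : List ℤ} (xPerm : IsSPerm n x) (zPerm : IsSPerm n z) where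
  private
    J     = join n (negate x) (negate z)
    JPerm = join-IsSPerm n (negate x) (negate z)

  meet-IsSPerm : IsSPerm n (meet n x z)
  meet-IsSPerm = negate-IsSPerm JPerm

  meet-lowerˡ : Weak n (meet n x z) x
  meet-lowerˡ = subst (Weak n (negate J)) (negate-involutive x)
    (negate-antitone (negate-IsSPerm xPerm) JPerm (join-upperˡ n _ _))

  meet-lowerʳ : Weak n (meet n x z) z
  meet-lowerʳ = subst (Weak n (negate J)) (negate-involutive z)
    (negate-antitone (negate-IsSPerm zPerm) JPerm (join-upperʳ n _ _))

  meet-greatest : ∀ {w} → IsSPerm n w → Weak n w x → Weak n w z → Weak n w (meet n x z)
  meet-greatest {w} wPerm w≤x w≤z = subst (λ v → Weak n v (negate J)) (negate-involutive w)
    (negate-antitone JPerm (negate-IsSPerm wPerm)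
      (join-least n _ _ (negate-antitone wPerm xPerm w≤x) (negate-antitone wPerm zPerm w≤z)))

-- The parabolic quotient as a sublattice

module _ (α : TypeBComp n) (1≤n : 1 ℕ.≤ n) where

  -- The quotient is cut out by forbidding inversions, so it is a lower set of the weak order.
  InHα-⊆ : ∀ {x z} → IsSPerm n x → Weak n x z → InHα α z → InHα α x
  InHα-⊆ xPerm x≤z (_ , noS₀ , noSᵢ) =
    xPerm ,
    (λ isJoin inv → noS₀ isJoin (Weak⇒≤weak x≤z ⟦ 1 ⟧ (s≤s z≤n , 1≤n) inv)) ,
    (λ i 1≤i i<n i∉ inv → noSᵢ i 1≤i i<n i∉
      (Weak⇒≤weak x≤z ⦅ i , suc i ⦆ (1≤i , ℕP.≤-refl , i<n) inv))

  -- No position lies strictly between the ends of a simple reflection (0 is no position), so a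
  -- chain inverting it is a single link and comes from `x` or `z`.
  join-InHα : ∀ {x z} → InHα α x → InHα α z → InHα α (join n x z)
  join-InHα {x} {z} (_ , xS₀ , xSᵢ) (_ , zS₀ , zSᵢ) =
    join-IsSPerm n x z ,
    (λ isJoin inv → Sum.[ xS₀ isJoin , zS₀ isJoin ]
      (simple ⟦ 1 ⟧ (s≤s z≤n , 1≤n) -1-1-adjacent inv)) ,
    (λ i 1≤i i<n i∉ inv → Sum.[ xSᵢ i 1≤i i<n i∉ , zSᵢ i 1≤i i<n i∉ ]
      (simple ⦅ i , suc i ⦆ (1≤i , ℕP.≤-refl , i<n) (λ _ → i-suci-adjacent i) inv))
    where
    simple : ∀ t → ValidRefl n t → (∀ (r : Pos n) → low t ℤ.< val r → val r ℤ.< high t → ⊥) →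
      Inv (join n x z) t → Inv x t ⊎ Inv z t
    simple t valid adjacent inv = Sum.map (ends⇒Inv x) (ends⇒Inv z)
        (single (join-Inv-chain n x z lo◁hi (Inv⇒ends (join n x z) inv)))
      where
      open Ends (ends t valid)
      T⇒◁ = Generated.T⇒◁ (join-generator n x z)
      single : TransClosure (JoinInv n x z) lo hi → x · hi ℤ.< x · lo ⊎ z · hi ℤ.< z · lo
      single [ _ , h ] = h
      single (_∷_ {y = r} (⟨ lo<r ⟩ , _) t) = contradiction
        (subst (val r ℤ.<_) val-hi (lt (T⇒◁ t)))
        (adjacent r (subst (ℤ._< val r) val-lo lo<r))
    -1-1-adjacent : ∀ (r : Pos n) → -[1+ 0 ] ℤ.< val r → val r ℤ.< + 1 → ⊥
    -1-1-adjacent (pos i) _ (ℤ.+<+ (s≤s ()))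
    -1-1-adjacent (neg i) (ℤ.-<- ()) _
    i-suci-adjacent : ∀ i {v} → + i ℤ.< v → v ℤ.< + suc i → ⊥
    i-suci-adjacent i (ℤ.+<+ i<v) (ℤ.+<+ v<1+i) = ℕP.<⇒≱ i<v (ℕP.≤-pred v<1+i)

-- Blocks of the composition

idx-≤ : ∀ {a x} as → x ℕ.≤ a → idx (a ∷ as) x ≡ 1
idx-≤ {a} {x} as x≤a with x ℕ.≤ᵇ a | ℕP.≤⇒≤ᵇ x≤a
... | true | _ = refl

idx-> : ∀ {a x} as → a ℕ.< x → idx (a ∷ as) x ≡ suc (idx as (x ℕ.∸ a))
idx-> {a} {x} as a<x with x ℕ.≤ᵇ a in eq
... | false = refl
... | true  = contradiction (ℕP.≤ᵇ⇒≤ x a (subst Bool.T (sym eq) tt)) (ℕP.<⇒≱ a<x)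

idx-positive : ∀ as {x} → 1 ℕ.≤ x → x ℕ.≤ sum as → 1 ℕ.≤ idx as x
idx-positive []       1≤x x≤0 = contradiction 1≤x (ℕP.≤⇒≯ x≤0)
idx-positive (a ∷ as) {x} _ _ with x ℕ.≤ᵇ a
... | true  = s≤s z≤n
... | false = s≤s z≤n

idx-mono : ∀ as {x y} → x ℕ.≤ y → idx as x ℕ.≤ idx as y
idx-mono []       x≤y = z≤n
idx-mono (a ∷ as) {x} {y} x≤y with y ℕ.≤? a | x ℕ.≤? a
... | yes y≤a | _ rewrite idx-≤ as y≤a | idx-≤ as (ℕP.≤-trans x≤y y≤a) = ℕP.≤-refl
... | no y≰a | yes x≤a rewrite idx-> as (ℕP.≰⇒> y≰a) | idx-≤ as x≤a = s≤s z≤n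
... | no y≰a | no x≰a rewrite idx-> as (ℕP.≰⇒> y≰a) | idx-> as (ℕP.≰⇒> x≰a) =
  s≤s (idx-mono as (ℕP.∸-monoˡ-≤ a x≤y))

-- Beyond the first part the remaining index is positive. The bound by the sum keeps `x` away from
-- the default 0 of `idx` on the empty list.
idx≡1⇒≤ : ∀ a as {x} → x ℕ.≤ sum (a ∷ as) → idx (a ∷ as) x ≡ 1 → x ℕ.≤ a
idx≡1⇒≤ a as {x} x≤sum idx≡1 with x ℕ.≤? a
... | yes x≤a = x≤a
... | no x≰a = contradiction (idx-positive as (ℕP.m<n⇒0<n∸m (ℕP.≰⇒> x≰a)) (ℕP.m≤n+o⇒m∸n≤o x a x≤sum))
    (ℕP.<⇒≱ (s≤s (ℕP.≤-reflexive (ℕP.suc-injective (trans (sym (idx-> as (ℕP.≰⇒> x≰a))) idx≡1)))))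

cuts-positive : ∀ {as c} → All (1 ℕ.≤_) as → c ∈ cuts as → 1 ℕ.≤ c
cuts-positive {a ∷ b ∷ as} (1≤a ∷ _) (here refl) = 1≤a
cuts-positive {a ∷ b ∷ as} (1≤a ∷ _) (there c∈) with ∈-map⁻ (a ℕ.+_) c∈
... | d , _ , refl = ℕP.≤-trans 1≤a (ℕP.m≤m+n a d)

-- Used contrapositively: neighbours in one block are not separated by a cut, so `InHα` forbids a
-- descent there.
idx-cut : ∀ {as c} → All (1 ℕ.≤_) as → c ∈ cuts as → idx as c ≢ idx as (suc c)
idx-cut {a ∷ b ∷ as} (_ ∷ 1≤b ∷ _) (here refl)
  rewrite idx-≤ (b ∷ as) (ℕP.≤-refl {a}) | idx-> (b ∷ as) (ℕP.n<1+n a)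
        | ℕP.m+n∸n≡m 1 a | idx-≤ as 1≤b = λ ()
idx-cut {a ∷ b ∷ as} (_ ∷ 1≤as) (there c∈) with ∈-map⁻ (a ℕ.+_) c∈
... | c , c∈ , refl
  rewrite idx-> (b ∷ as) (ℕP.m<m+n a (cuts-positive 1≤as c∈))
        | idx-> (b ∷ as) (s≤s (ℕP.m≤m+n a c))
        | sym (ℕP.+-suc a c) | ℕP.m+n∸m≡n a c | ℕP.m+n∸m≡n a (suc c) =
  idx-cut 1≤as c∈ ∘ ℕP.suc-injective

-- The block equal to its own opposite exists only for join compositions, where it has label 1.
isCenter : Bool → ℤ → Bool
isCenter false (+ 1) = true
isCenter _     _     = false

oppLabel : Bool → ℤ → ℤ
oppLabel false (+ 1) = + 1
oppLabel _     l     = - l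

negLabel-antitone : ∀ s {a b} → a ℕ.≤ b → negLabel s (suc b) ℤ.≤ negLabel s (suc a)
negLabel-antitone true                  a≤b = ℤ.-≤- a≤b
negLabel-antitone false {zero}  {zero}  a≤b = ℤP.≤-refl
negLabel-antitone false {zero}  {suc b} a≤b = ℤ.-≤+
negLabel-antitone false {suc a} {suc b} a≤b = ℤ.-≤- a≤b

negLabel-≤+ : ∀ s {a b} → negLabel s (suc a) ℤ.≤ + suc b
negLabel-≤+ true          = ℤ.-≤+
negLabel-≤+ false {zero}  = ℤ.+≤+ (s≤s z≤n)
negLabel-≤+ false {suc a} = ℤ.-≤+

negLabel≡+ : ∀ s {a b} → negLabel s (suc a) ≡ + suc b → s ≡ false × a ≡ 0 × b ≡ 0
negLabel≡+ false {zero} refl = refl , refl , refl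

oppLabel-+ : ∀ s a → oppLabel s (+ suc a) ≡ negLabel s (suc a)
oppLabel-+ true  a       = refl
oppLabel-+ false zero    = refl
oppLabel-+ false (suc a) = refl

oppLabel-negLabel : ∀ s a → oppLabel s (negLabel s (suc a)) ≡ + suc a
oppLabel-negLabel true  a       = refl
oppLabel-negLabel false zero    = refl
oppLabel-negLabel false (suc a) = refl

isCenter-negLabel : ∀ s a → isCenter s (negLabel s (suc a)) ≡ isCenter s (+ suc a)
isCenter-negLabel true  zero    = refl
isCenter-negLabel true  (suc a) = refl
isCenter-negLabel false zero    = refl
isCenter-negLabel false (suc a) = refl

module Blocks {n} (α : TypeBComp n) where

  opaque
    lab : Pos n → ℤ
    lab p = blockLabel α (val p)

    lab≡blockLabel : ∀ p → lab p ≡ blockLabel α (val p)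
    lab≡blockLabel p = refl

  block : Fin n → ℕ
  block i = ℕ.pred (idx (parts α) (suc (toℕ i)))

  idx≡suc-block : ∀ i → idx (parts α) (suc (toℕ i)) ≡ suc (block i)
  idx≡suc-block i with idx (parts α) (suc (toℕ i))
    | idx-positive (parts α) {suc (toℕ i)} (s≤s z≤n) (subst (suc (toℕ i) ℕ.≤_) (sym (parts-sum α)) (toℕ<n i))
  ... | suc _ | _ = refl

  block-mono : ∀ {i j} → toℕ i ℕ.≤ toℕ j → block i ℕ.≤ block j
  block-mono i≤j = ℕP.pred-mono-≤ (idx-mono (parts α) (s≤s i≤j))

  lab-pos : ∀ i → lab (pos i) ≡ + suc (block i)
  lab-pos i = trans (lab≡blockLabel (pos i)) (cong +_ (idx≡suc-block i))

  lab-neg : ∀ i → lab (neg i) ≡ negLabel (split α) (suc (block i))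
  lab-neg i = trans (lab≡blockLabel (neg i)) (cong (negLabel (split α)) (idx≡suc-block i))

  lab-mono : ∀ {p q} → p ⊴ q → lab p ℤ.≤ lab q
  lab-mono {pos i} {pos j} ⟨ ℤ.+≤+ (s≤s i≤j) ⟩ rewrite lab-pos i | lab-pos j =
    ℤ.+≤+ (s≤s (block-mono {i} {j} i≤j))
  lab-mono {neg i} {pos j} _ rewrite lab-neg i | lab-pos j = negLabel-≤+ (split α)
  lab-mono {neg i} {neg j} ⟨ ℤ.-≤- j≤i ⟩ rewrite lab-neg i | lab-neg j =
    negLabel-antitone (split α) (block-mono {j} {i} j≤i)

  -- Blocks are intervals because labels are monotone along the positions.
  lab-convex : ∀ {p q r} → p ⊴ q → q ⊴ r → lab p ≡ lab r → lab q ≡ lab p × lab q ≡ lab r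
  lab-convex {p} {q} p⊴q q⊴r eq = q≡p , trans q≡p eq
    where q≡p = ℤP.≤-antisym (subst (lab q ℤ.≤_) (sym eq) (lab-mono q⊴r)) (lab-mono p⊴q)

  lab-oppLabel : ∀ p → lab (opp p) ≡ oppLabel (split α) (lab p)
  lab-oppLabel (pos i) rewrite lab-neg i | lab-pos i = sym (oppLabel-+ (split α) (block i))
  lab-oppLabel (neg i) rewrite lab-neg i | lab-pos i = sym (oppLabel-negLabel (split α) (block i))

  lab-opp : ∀ {p q} → lab p ≡ lab q → lab (opp p) ≡ lab (opp q)
  lab-opp {p} {q} eq =
    trans (lab-oppLabel p) (trans (cong (oppLabel (split α)) eq) (sym (lab-oppLabel q)))

  lab-opp⁻ : ∀ {p q} → lab (opp p) ≡ lab (opp q) → lab p ≡ lab q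
  lab-opp⁻ {p} {q} eq =
    subst₂ (λ p q → lab p ≡ lab q) (opp-involutive p) (opp-involutive q) (lab-opp {opp p} {opp q} eq)

  -- A position between the ends i and k of a descent, outside their blocks, must take a
  -- value above that of i if its side is true, and below that of k if its side is false:
  -- for positive positions this says that there is no 231-pattern, and for negative ones
  -- it is the image of this condition under p ↦ -p.
  side : Pos n → Bool
  side (pos i) = isCenter (split α) (lab (pos i))
  side (neg i) = not (isCenter (split α) (lab (neg i)))

  side-opp : ∀ p → side (opp p) ≡ not (side p)
  side-opp (pos i) rewrite lab-neg i | lab-pos i = cong not (isCenter-negLabel (split α) (block i))
  side-opp (neg i) rewrite lab-neg i | lab-pos i =
    trans (sym (isCenter-negLabel (split α) (block i))) (sym (not-involutive _))

  -- Sides are constant on every block but the central one, whose negative half has `false` and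
  -- whose positive half has `true`.
  side-up : ∀ {p q} → p ⊴ q → lab p ≡ lab q → side p ≡ true → side q ≡ true
  side-up {pos i} {pos j} _ eq h = trans (cong (isCenter (split α)) (sym eq)) h
  side-up {neg i} {neg j} _ eq h = trans (cong (not ∘ isCenter (split α)) (sym eq)) h
  side-up {neg i} {pos j} _ eq h
    with s≡ , _ , b≡ ← negLabel≡+ (split α) (trans (sym (lab-neg i)) (trans eq (lab-pos j)))
    rewrite lab-pos j | s≡ | b≡ = refl

  Increasing : List ℤ → Set
  Increasing x = ∀ {p q} → p ◁ q → lab p ≡ lab q → x · p ℤ.< x · q

  -- Positive neighbours in a block increase since no cut separates them, and negative ones by
  -- symmetry. Only the central block crosses 0; there the absence of `⟦ 1 ⟧` makes the values at
  -- its positive positions positive.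
  InHα⇒Increasing : 1 ℕ.≤ n → ∀ {x} → InHα α x → Increasing x
  InHα⇒Increasing 1≤n {x} (perm , noS₀ , noSᵢ) = increasing
    where
    open SignedPerm (IsSPerm⇒SignedPerm perm)

    step : ∀ k → suc k ℕ.< n → idx (parts α) (suc k) ≡ idx (parts α) (suc (suc k)) →
      nth x k ℤ.< nth x (suc k)
    step k k+1<n same-block =
      ℤP.≤∧≢⇒< (ℤP.≮⇒≥ (noSᵢ (suc k) (s≤s z≤n) k+1<n
                  (λ cut → idx-cut (parts-pos α) cut same-block)))
        (λ eq → ℕP.<⇒≢ ℕP.≤-refl (trans (sym (toℕ-fromℕ< (ℕP.<⇒≤ k+1<n)))
          (trans (cong toℕ (nth-Unique x (proj₁ perm) (proj₂ (proj₂ perm)) {i = fromℕ< (ℕP.<⇒≤ k+1<n)} {j = fromℕ< k+1<n}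
            (trans (cong (∣_∣ ∘ nth x) (toℕ-fromℕ< (ℕP.<⇒≤ k+1<n)))
              (trans (cong ∣_∣ eq) (cong (∣_∣ ∘ nth x) (sym (toℕ-fromℕ< k+1<n)))))))
            (toℕ-fromℕ< k+1<n))))

    steps : ∀ {k l} → k ℕ.<′ l → l ℕ.< n → idx (parts α) (suc k) ≡ idx (parts α) (suc l) →
      nth x k ℤ.< nth x l
    steps ℕ.<′-base l<n eq = step _ l<n eq
    steps {k} {suc l} (ℕ.≤′-step k<l) l<n eq = ℤP.<-trans (steps k<l (ℕP.<⇒≤ l<n) (ℕP.≤-antisym lower upper))
        (step l l<n (ℕP.≤-antisym (idx-mono (parts α) (ℕP.n≤1+n _)) (subst (ℕ._≤ idx (parts α) (suc l)) eq lower)))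
      where
      lower = idx-mono (parts α) (s≤s (ℕP.<⇒≤ (ℕP.≤′⇒≤ k<l)))
      upper = subst (idx (parts α) (suc l) ℕ.≤_) (sym eq) (idx-mono (parts α) (ℕP.n≤1+n (suc l)))

    increasing⁺ : ∀ {i j} → pos i ◁ pos j → lab (pos i) ≡ lab (pos j) → x · pos i ℤ.< x · pos j
    increasing⁺ {i} {j} ⟨ ℤ.+<+ (s≤s i<j) ⟩ eq = steps (ℕP.≤⇒≤′ i<j) (toℕ<n j) (ℤP.+-injective
      (trans (sym (lab≡blockLabel (pos i))) (trans eq (lab≡blockLabel (pos j)))))

    first-positive : split α ≡ false → ∀ {o} → val (pos o) ≡ + 1 → 0ℤ ℤ.< x · pos o
    first-positive isJoin {o} val≡1 =
      ℤP.≤∧≢⇒< (ℤP.≮⇒≥ (noS₀ isJoin ∘ subst (λ v → ap x v ℤ.< 0ℤ) val≡1)) (nonzero (pos o) ∘ sym)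

    center-positive : split α ≡ false → ∀ j → block j ≡ 0 → 0ℤ ℤ.< x · pos j
    center-positive isJoin j block≡0 with position {n = n} (+ 1) ((λ ()) , 1≤n)
    ... | pos o , val≡1
      with ⊴⇒≡⊎◁ {p = pos o} {q = pos j} ⟨ subst (ℤ._≤ val (pos j)) (sym val≡1) (ℤ.+≤+ (s≤s z≤n)) ⟩
    ...   | inj₁ refl = first-positive isJoin val≡1
    ...   | inj₂ o◁j  = ℤP.<-trans (first-positive isJoin val≡1) (increasing⁺ o◁j
              (trans (lab-pos o) (trans (cong (+_ ∘ suc) block-o≡block-j) (sym (lab-pos j)))))
      where
      o≤j : toℕ o ℕ.≤ toℕ j
      o≤j = ℕP.≤-pred (ℤP.drop‿+≤+ (ℤP.<⇒≤ (lt o◁j)))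
      block-o≡block-j : block o ≡ block j
      block-o≡block-j = trans (ℕP.n≤0⇒n≡0 (subst (block o ℕ.≤_) block≡0 (block-mono {o} {j} o≤j)))
                              (sym block≡0)

    increasing : Increasing x
    increasing {pos i} {pos j} p◁q eq = increasing⁺ p◁q eq
    increasing {neg i} {neg j} p◁q eq =
      ·-opp-< x {pos j} {pos i} (increasing⁺ (opp-◁ p◁q) (lab-opp {neg j} {neg i} (sym eq)))
    increasing {neg i} {pos j} p◁q eq
      with isJoin , bi , bj ← negLabel≡+ (split α) (trans (sym (lab-neg i)) (trans eq (lab-pos j))) =
      ℤP.<-trans (ℤP.neg-mono-< (center-positive isJoin i bi)) (center-positive isJoin j bj)
    increasing {pos i} {neg j} ⟨ () ⟩

  -- The value condition of a 231-pattern, written uniformly for split and join compositions and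
  -- extended to negative `j`.
  Obstruction : List ℤ → Pos n → Pos n → Pos n → Set
  Obstruction x i j k = (side j ≡ false × x · i ℤ.< x · j) ⊎ (side j ≡ true × x · j ℤ.< x · k)

  side-≤firstPart : split α ≡ false → ∀ j → suc (toℕ j) ℕ.≤ firstPart (parts α) → side (pos j) ≡ true
  side-≤firstPart isJoin j j≤a rewrite isJoin | lab≡blockLabel (pos j) with parts α
  ... | a ∷ as rewrite idx-≤ as j≤a = refl

  side->firstPart : split α ≡ false → ∀ j → firstPart (parts α) ℕ.< suc (toℕ j) → side (pos j) ≡ false
  side->firstPart isJoin j a<j rewrite isJoin | lab≡blockLabel (pos j) with parts α | parts-sum α
  ... | []     | refl = contradiction j λ ()
  ... | a ∷ as | sum≡n with idx (a ∷ as) (suc (toℕ j)) in eq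
  ...   | 0           = refl
  ...   | suc (suc _) = refl
  ...   | 1           = contradiction (idx≡1⇒≤ a as (subst (suc (toℕ j) ℕ.≤_) (sym sum≡n) (toℕ<n j)) eq) (ℕP.<⇒≱ a<j)

  side-split : split α ≡ true → ∀ j → side (pos j) ≡ false
  side-split isSplit j rewrite isSplit = refl

  pattern⇒obstruction : ∀ {x} i j k → Pattern231 α x (val i) (val (pos j)) (val k) →
    BaseTriple α x (val i) (val (pos j)) (val k) × Obstruction x i (pos j) k
  pattern⇒obstruction {x} i j k = go (split α) refl
    where
    go : ∀ s → split α ≡ s →
      (if s then SplitPattern α x (val i) (val (pos j)) (val k)
            else JoinPattern α x (val i) (val (pos j)) (val k)) →
      BaseTriple α x (val i) (val (pos j)) (val k) × Obstruction x i (pos j) k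
    go true  s≡ (base , i<j)                        = base , inj₁ (side-split s≡ j , i<j)
    go false s≡ (base , inj₁ (ℤ.+<+ a<j , i<j))     = base , inj₁ (side->firstPart s≡ j a<j , i<j)
    go false s≡ (base , inj₂ (ℤ.+≤+ j≤a , j<k))     = base , inj₂ (side-≤firstPart s≡ j j≤a , j<k)

  obstruction⇒pattern : ∀ {x} i j k → BaseTriple α x (val i) (val (pos j)) (val k) →
    Obstruction x i (pos j) k → Pattern231 α x (val i) (val (pos j)) (val k)
  obstruction⇒pattern {x} i j k base = go (split α) refl
    where
    go : ∀ s → split α ≡ s → Obstruction x i (pos j) k →
      (if s then SplitPattern α x (val i) (val (pos j)) (val k)
            else JoinPattern α x (val i) (val (pos j)) (val k))
    go true  s≡ (inj₁ (_ , i<j)) = base , i<j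
    go true  s≡ (inj₂ (side≡true , _)) = contradiction (trans (sym side≡true) (side-split s≡ j)) λ ()
    go false s≡ obs with suc (toℕ j) ℕ.≤? firstPart (parts α) | obs
    ... | yes j≤a | inj₂ (_ , j<k) = base , inj₂ (ℤ.+≤+ j≤a , j<k)
    ... | no j≰a  | inj₁ (_ , i<j) = base , inj₁ (ℤ.+<+ (ℕP.≰⇒> j≰a) , i<j)
    ... | yes j≤a | inj₁ (side≡false , _) =
      contradiction (trans (sym side≡false) (side-≤firstPart s≡ j j≤a)) λ ()
    ... | no j≰a  | inj₂ (side≡true , _)  =
      contradiction (trans (sym side≡true) (side->firstPart s≡ j (ℕP.≰⇒> j≰a))) λ ()

-- Arcs

module Arcs {n} (α : TypeBComp n) where
  open Blocks α public

  true≢false : true ≢ false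
  true≢false ()

  -- col i k j tells on which side of the uncontracted arc from i to k the position j
  -- lies: true for values above that of i, false for values below that of k.
  opaque
    col : Pos n → Pos n → Pos n → Bool
    col i k j with lab j ℤP.≟ lab i | lab j ℤP.≟ lab k
    ... | yes _ | _     = true
    ... | no _  | yes _ = false
    ... | no _  | no _  = side j

    col-start : ∀ {i k j} → lab j ≡ lab i → col i k j ≡ true
    col-start {i} {k} {j} j≡i with lab j ℤP.≟ lab i | lab j ℤP.≟ lab k
    ... | yes _  | _ = refl
    ... | no j≢i | _ = contradiction j≡i j≢i

    col-end : ∀ {i k j} → lab j ≢ lab i → lab j ≡ lab k → col i k j ≡ false
    col-end {i} {k} {j} j≢i j≡k with lab j ℤP.≟ lab i | lab j ℤP.≟ lab k
    ... | yes j≡i | _      = contradiction j≡i j≢i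
    ... | no _    | yes _  = refl
    ... | no _    | no j≢k = contradiction j≡k j≢k

    col-inner : ∀ {i k j} → lab j ≢ lab i → lab j ≢ lab k → col i k j ≡ side j
    col-inner {i} {k} {j} j≢i j≢k with lab j ℤP.≟ lab i | lab j ℤP.≟ lab k
    ... | yes j≡i | _       = contradiction j≡i j≢i
    ... | no _    | yes j≡k = contradiction j≡k j≢k
    ... | no _    | no _    = refl

  data Col (i k j : Pos n) : Set where
    start : lab j ≡ lab i → col i k j ≡ true → Col i k j
    end   : lab j ≢ lab i → lab j ≡ lab k → col i k j ≡ false → Col i k j
    inner : lab j ≢ lab i → lab j ≢ lab k → col i k j ≡ side j → Col i k j

  col-view : ∀ i k j → Col i k j
  col-view i k j with lab j ℤP.≟ lab i | lab j ℤP.≟ lab k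
  ... | yes j≡i | _       = start j≡i (col-start j≡i)
  ... | no j≢i  | yes j≡k = end j≢i j≡k (col-end j≢i j≡k)
  ... | no j≢i  | no j≢k  = inner j≢i j≢k (col-inner j≢i j≢k)

  side-down : ∀ {p q} → p ⊴ q → lab p ≡ lab q → side q ≡ false → side p ≡ false
  side-down {p} p⊴q eq q≡false with side p in p≡
  ... | false = refl
  ... | true  = contradiction (trans (sym (side-up p⊴q eq p≡)) q≡false) true≢false

  -- Moving the end to `j` could only change positions in the block of `j`. Those before `j` are
  -- already on the lower side, by `side-down`.
  col-shrinkʳ : ∀ {i j k p} → col i k j ≡ false → p ⊴ j → j ⊴ k → col i j p ≡ col i k p
  col-shrinkʳ {i} {j} {k} {p} cj p⊴j j⊴k with col-view i k p
  ... | start p≡i c = trans (col-start p≡i) (sym c)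
  ... | end p≢i p≡k c =
    trans (col-end p≢i (sym (proj₁ (lab-convex p⊴j j⊴k p≡k)))) (sym c)
  ... | inner p≢i p≢k c with lab p ℤP.≟ lab j
  ...   | no p≢j  = trans (col-inner p≢i p≢j) (sym c)
  ...   | yes p≡j = trans (col-end p≢i p≡j) (sym (trans c (side-down p⊴j p≡j
            (trans (sym (col-inner (p≢i ∘ trans p≡j) (p≢k ∘ trans p≡j))) cj))))

  col-shrinkˡ : ∀ {i j k p} → col i k j ≡ true → i ⊴ j → j ⊴ p → col j k p ≡ col i k p
  col-shrinkˡ {i} {j} {k} {p} cj i⊴j j⊴p with col-view i k p
  ... | start p≡i c = trans (col-start (sym (proj₂ (lab-convex i⊴j j⊴p (sym p≡i))))) (sym c)
  ... | end p≢i p≡k c with lab p ℤP.≟ lab j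
  ...   | no p≢j  = trans (col-end p≢j p≡k) (sym c)
  ...   | yes p≡j = contradiction
            (trans (sym cj) (col-end (p≢i ∘ trans p≡j) (trans (sym p≡j) p≡k))) true≢false
  col-shrinkˡ {i} {j} {k} {p} cj i⊴j j⊴p | inner p≢i p≢k c with lab p ℤP.≟ lab j
  ...   | no p≢j  = trans (col-inner p≢j p≢k) (sym c)
  ...   | yes p≡j = trans (col-start p≡j) (sym (trans c (side-up j⊴p (sym p≡j)
            (trans (sym (col-inner (p≢i ∘ trans p≡j) (p≢k ∘ trans p≡j))) cj))))

  col-shrink : ∀ {i k p q r} → i ⊴ p → q ⊴ k → col i k p ≡ true → col i k q ≡ false →
    p ⊴ r → r ⊴ q → col p q r ≡ col i k r
  col-shrink {i} {k} {p} {q} i⊴p q⊴k cp cq p⊴r r⊴q =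
    trans (col-shrinkʳ {i = p} (trans (col-shrinkˡ {i = i} cp i⊴p (⊴-trans p⊴r r⊴q)) cq) r⊴q q⊴k)
          (col-shrinkˡ cp i⊴p p⊴r)

  -- Going up within a block, the side can only change from `false` to `true`.
  col-distinct : ∀ {i k p q} → p ⊴ q → col i k p ≡ true → col i k q ≡ false → lab p ≢ lab q
  col-distinct {i} {k} {p} {q} p⊴q cp cq p≡q with col-view i k p
  ... | start p≡i _   = true≢false (trans (sym (col-start (trans (sym p≡q) p≡i))) cq)
  ... | end _ _ c     = true≢false (trans (sym cp) c)
  ... | inner p≢i p≢k c = true≢false (trans (sym (side-up p⊴q p≡q (trans (sym c) cp)))
          (trans (sym (col-inner (p≢i ∘ trans p≡q) (p≢k ∘ trans p≡q))) cq))

  -- Taking opposites exchanges the two end blocks and flips every side in between.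
  col-opp : ∀ {i k} j → lab i ≢ lab k → col (opp k) (opp i) (opp j) ≡ not (col i k j)
  col-opp {i} {k} j i≢k with col-view i k j
  ... | start j≡i c     = trans (col-end (λ j≡k → i≢k (trans (sym j≡i) (lab-opp⁻ {j} {k} j≡k)))
                                         (lab-opp {j} {i} j≡i)) (cong not (sym c))
  ... | end j≢i j≡k c   = trans (col-start (lab-opp {j} {k} j≡k)) (cong not (sym c))
  ... | inner j≢i j≢k c = trans (col-inner (j≢k ∘ lab-opp⁻ {j} {k}) (j≢i ∘ lab-opp⁻ {j} {i}))
                            (trans (side-opp j) (cong not (sym c)))

  -- The join-irreducible of the arc from i to k lies below x.
  record Above (x : List ℤ) (i k : Pos n) : Set where
    constructor above
    field
      i◁k : i ◁ k
      i≢k : lab i ≢ lab k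
      arc : ∀ p q → i ⊴ p → p ◁ q → q ⊴ k → col i k p ≡ true → col i k q ≡ false → x · q ℤ.< x · p

  -- x lies below the meet-irreducible of the arc from i to k.
  Under : List ℤ → Pos n → Pos n → Set
  Under x i k = ∀ {p q} → i ⊴ p → p ◁ q → q ⊴ k →
    p ≡ i ⊎ col i k p ≡ false → q ≡ k ⊎ col i k q ≡ true → x · p ℤ.< x · q

  above? : ∀ x i k → Dec (Above x i k)
  above? x i k = map′ (λ (a , b , c) → above a b c) (λ (above a b c) → a , b , c)
    ((i ◁? k) ×-dec ¬? (lab i ℤP.≟ lab k) ×-dec
      ∀Pos? λ p → ∀Pos? λ q → (i ⊴? p) →-dec (p ◁? q) →-dec (q ⊴? k) →-dec
        (col i k p ≟ᵇ true) →-dec (col i k q ≟ᵇ false) →-dec (x · q ℤP.<? x · p))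

  -- By `col-shrink` the arc from `p` to `q` has the same sides as the larger arc, so its conditions
  -- are among those of the larger one.
  above-shrink : ∀ {x i k p q} → Above x i k → i ⊴ p → p ◁ q → q ⊴ k →
    col i k p ≡ true → col i k q ≡ false → Above x p q
  above-shrink {x} {i} {k} {p} {q} (above _ _ arc) i⊴p p◁q q⊴k cp cq =
    above p◁q (col-distinct (◁⇒⊴ p◁q) cp cq) (λ r s p⊴r r◁s s⊴q cr cs →
      arc r s (⊴-trans i⊴p p⊴r) r◁s (⊴-trans s⊴q q⊴k)
        (trans (sym (shrink p⊴r (⊴-trans (◁⇒⊴ r◁s) s⊴q))) cr)
        (trans (sym (shrink (⊴-trans p⊴r (◁⇒⊴ r◁s)) s⊴q)) cs))
    where
    shrink : ∀ {r} → p ⊴ r → r ⊴ q → col p q r ≡ col i k r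
    shrink = col-shrink i⊴p q⊴k cp cq

  above⇒inversion : ∀ {x i k} → Above x i k → x · k ℤ.< x · i
  above⇒inversion {i = i} {k} (above i◁k i≢k arc) =
    arc i k ⊴-refl i◁k ⊴-refl (col-start refl) (col-end (i≢k ∘ sym) refl)

  above-opp : ∀ {x i k} → Above x i k → Above x (opp k) (opp i)
  above-opp {x} {i} {k} (above i◁k i≢k arc) =
    above (opp-◁ i◁k) (i≢k ∘ sym ∘ lab-opp⁻ {k} {i}) (λ p q k⊴p p◁q q⊴i cp cq →
      subst₂ (λ p q → x · q ℤ.< x · p) (opp-involutive p) (opp-involutive q)
        (·-opp-< x {opp p} {opp q} (arc (opp q) (opp p)
          (subst (_⊴ opp q) (opp-involutive i) (opp-⊴ q⊴i)) (opp-◁ p◁q)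
          (subst (opp p ⊴_) (opp-involutive k) (opp-⊴ k⊴p))
          (flip q cq) (flip p cp))))
    where
    flip : ∀ p {b} → col (opp k) (opp i) p ≡ b → col i k (opp p) ≡ not b
    flip p {b} eq = trans (sym (not-involutive _)) (cong not (trans (sym (col-opp (opp p) i≢k))
      (trans (cong (col (opp k) (opp i)) (opp-involutive p)) eq)))

  above-generator : ∀ x → Generator n (Above x)
  above-generator x = record
    { E?      = above? x
    ; E⇒◁     = Above.i◁k
    ; E-opp   = above-opp
    ; E-split = above-split
    }
    where
    above-split : ∀ {i j k} → Above x i k → i ◁ j → j ◁ k → Above x i j ⊎ Above x j k
    -- An upper position can serve as the new start of the arc, a lower one as its new end.
    above-split {i} {j} {k} ab i◁j j◁k with col i k j in eq
    ... | true  = inj₂ (above-shrink ab (◁⇒⊴ i◁j) j◁k ⊴-refl eq (col-end (Above.i≢k ab ∘ sym) refl))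
    ... | false = inj₁ (above-shrink ab ⊴-refl i◁j (◁⇒⊴ j◁k) (col-start refl) eq)

  above-mono : ∀ {x z i k} → Weak n x z → Above x i k → Above z i k
  above-mono (weak x≤z) (above i◁k i≢k arc) = above i◁k i≢k
    (λ p q i⊴p p◁q q⊴k cp cq → x≤z p◁q (arc p q i⊴p p◁q q⊴k cp cq))

  -- The arc preorder and the projection

  infix 4 _≼_

  record _≼_ (x z : List ℤ) : Set where
    constructor ⟪_⟫
    field above-⊆ : ∀ {i k} → Above x i k → Above z i k
  open _≼_ public

  ≼-trans : ∀ {x y z} → x ≼ y → y ≼ z → x ≼ z
  ≼-trans ⟪ f ⟫ ⟪ g ⟫ = ⟪ (λ ab → g (f ab)) ⟫

  Weak⇒≼ : ∀ {x z} → Weak n x z → x ≼ z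
  Weak⇒≼ x≤z = ⟪ above-mono x≤z ⟫

  proj : List ℤ → List ℤ
  proj x = Generated.generated (above-generator x)

  proj-IsSPerm : ∀ x → IsSPerm n (proj x)
  proj-IsSPerm x = Generated.generated-IsSPerm (above-generator x)

  proj-chain : ∀ x {p q} → p ◁ q → proj x · q ℤ.< proj x · p → TransClosure (Above x) p q
  proj-chain x = Generated.inversion⇒T (above-generator x)

  above-proj : ∀ x {i k} → Above x i k → proj x · k ℤ.< proj x · i
  above-proj x ab = Generated.T⇒inversion (above-generator x) [ ab ]

  proj-≤ : ∀ x → Weak n (proj x) x
  proj-≤ x = weak (λ p◁q inv → chain⇒inversion (proj-chain x p◁q inv))
    where
    chain⇒inversion : ∀ {p q} → TransClosure (Above x) p q → x · q ℤ.< x · p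
    chain⇒inversion [ ab ]   = above⇒inversion ab
    chain⇒inversion (ab ∷ t) = ℤP.<-trans (chain⇒inversion t) (above⇒inversion ab)

  -- Each pair that an arc requires to be inverted spans a smaller arc of `Above x`, hence is an
  -- inversion of `proj x`.
  ≼-proj : ∀ x → x ≼ proj x
  ≼-proj x = ⟪ (λ ab → above (Above.i◁k ab) (Above.i≢k ab) (λ p q i⊴p p◁q q⊴k cp cq →
    above-proj x (above-shrink ab i⊴p p◁q q⊴k cp cq))) ⟫

  proj-mono : ∀ {x z} → x ≼ z → Weak n (proj x) (proj z)
  proj-mono {x} {z} x≼z = weak (λ p◁q inv →
      Generated.T⇒inversion (above-generator z) (chain (proj-chain x p◁q inv)))
    where
    chain : ∀ {p q} → TransClosure (Above x) p q → TransClosure (Above z) p q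
    chain [ ab ]   = [ above-⊆ x≼z ab ]
    chain (ab ∷ t) = above-⊆ x≼z ab ∷ chain t

  proj-mono⁻ : ∀ {x z} → Weak n (proj x) (proj z) → x ≼ z
  proj-mono⁻ {x} {z} le = ≼-trans (≼-proj x) (Weak⇒≼ (Weak-trans le (proj-≤ z)))

  -- Duality between `Above` and `Under`

  -- Suppose `x` inverts a low `p` and a high `q`, but no shorter such pair. Then `x` lies above the
  -- arc from `p` to `q`, and so does `y`; hence `y` inverts the pair, against `Under y i k`. That
  -- `x` increases on blocks settles the positions in the blocks of `p` and `q`.
  ≼⇒Under-⊇ : ∀ {x y} → IsSPerm n x → Increasing x → x ≼ y →
    ∀ {i k} → Under y i k → Under x i k
  ≼⇒Under-⊇ {x} {y} xPerm incr x≼y {i} {k} underY i⊴p p◁q q⊴k lowP highQ =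
    interval-induction Goal step p◁q i⊴p q⊴k lowP highQ
    where
    open SignedPerm (IsSPerm⇒SignedPerm xPerm)
    Goal : Pos n → Pos n → Set
    Goal p q = i ⊴ p → q ⊴ k → p ≡ i ⊎ col i k p ≡ false → q ≡ k ⊎ col i k q ≡ true → x · p ℤ.< x · q
    step : ∀ {p q} → p ◁ q → (∀ {r} → p ◁ r → r ◁ q → Goal p r) →
      (∀ {r} → p ◁ r → r ◁ q → Goal r q) → Goal p q
    step {p} {q} p◁q recˡ recʳ i⊴p q⊴k lowP highQ with ℤP.<-cmp (x · p) (x · q)
    ... | tri< p<q _ _ = p<q
    ... | tri≈ _ p≡q _ = contradiction (subst (_◁ q) (injective p≡q) p◁q) ◁-irrefl
    ... | tri> _ _ q<p = contradiction (above⇒inversion (above-⊆ x≼y aboveX))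
                                       (ℤP.<-asym (underY i⊴p p◁q q⊴k lowP highQ))
      where
      p≢q : lab p ≢ lab q
      p≢q eq = ℤP.<-asym q<p (incr p◁q eq)
      -- A position inner to the arc from `p` to `q` is, by convexity of blocks, inner to the arc
      -- from `i` to `k`; both arcs then use its `side`.
      not-i : ∀ {r} → p ⊴ r → lab r ≢ lab p → lab r ≢ lab i
      not-i p⊴r r≢p r≡i = r≢p (sym (proj₂ (lab-convex i⊴p p⊴r (sym r≡i))))
      not-k : ∀ {r} → r ⊴ q → lab r ≢ lab q → lab r ≢ lab k
      not-k r⊴q r≢q r≡k = r≢q (sym (proj₁ (lab-convex r⊴q q⊴k r≡k)))
      at-least : ∀ {r} → p ⊴ r → r ⊴ q → col p q r ≡ true → x · p ℤ.≤ x · r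
      at-least {r} p⊴r r⊴q c with ⊴⇒≡⊎◁ p⊴r | ⊴⇒≡⊎◁ r⊴q
      ... | inj₁ refl | _         = ℤP.≤-refl
      ... | inj₂ _    | inj₁ refl = contradiction (trans (sym c) (col-end (p≢q ∘ sym) refl)) true≢false
      ... | inj₂ p◁r  | inj₂ r◁q with col i k r in cr
      ...   | true  = ℤP.<⇒≤ (recˡ p◁r r◁q i⊴p (⊴-trans r⊴q q⊴k) lowP (inj₂ cr))
      ...   | false with col-view p q r
      ...     | start r≡p _ = ℤP.<⇒≤ (incr p◁r (sym r≡p))
      ...     | end _ _ c′  = contradiction (trans (sym c) c′) true≢false
      ...     | inner r≢p r≢q c′ = contradiction
                (trans (sym c) (trans c′ (trans (sym (col-inner (not-i p⊴r r≢p) (not-k r⊴q r≢q))) cr)))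
                true≢false
      at-most : ∀ {r} → p ⊴ r → r ⊴ q → col p q r ≡ false → x · r ℤ.≤ x · q
      at-most {r} p⊴r r⊴q c with ⊴⇒≡⊎◁ p⊴r | ⊴⇒≡⊎◁ r⊴q
      ... | _         | inj₁ refl = ℤP.≤-refl
      ... | inj₁ refl | inj₂ _    = contradiction (trans (sym (col-start refl)) c) true≢false
      ... | inj₂ p◁r  | inj₂ r◁q with col i k r in cr
      ...   | false = ℤP.<⇒≤ (recʳ p◁r r◁q (⊴-trans i⊴p p⊴r) q⊴k (inj₂ cr) highQ)
      ...   | true with col-view p q r
      ...     | start _ c′  = contradiction (trans (sym c′) c) true≢false
      ...     | end _ r≡q _ = ℤP.<⇒≤ (incr r◁q r≡q)
      ...     | inner r≢p r≢q c′ = contradiction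
                (trans (sym cr) (trans (col-inner (not-i p⊴r r≢p) (not-k r⊴q r≢q)) (trans (sym c′) c)))
                true≢false
      aboveX : Above x p q
      aboveX = above p◁q p≢q (λ r s p⊴r r◁s s⊴q cr cs →
        ℤP.≤-<-trans (at-most (⊴-trans p⊴r (◁⇒⊴ r◁s)) s⊴q cs)
          (ℤP.<-≤-trans q<p (at-least p⊴r (⊴-trans (◁⇒⊴ r◁s) s⊴q) cr)))

  -- The dual argument: if `y` fails to invert `p` and `q` but inverts all shorter required pairs,
  -- then `y` lies under the arc from `p` to `q`. So does `x`, although `x` inverts this pair.
  Under-⊇⇒≼ : ∀ {x y} → IsSPerm n y →
    (∀ {i k} → lab i ≢ lab k → Under y i k → Under x i k) → x ≼ y
  Under-⊇⇒≼ {x} {y} yPerm under = ⟪ aboveY ⟫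
    where
    open SignedPerm (IsSPerm⇒SignedPerm yPerm)
    aboveY : ∀ {i k} → Above x i k → Above y i k
    aboveY {i} {k} (above i◁k i≢k arc) = above i◁k i≢k (λ p q i⊴p p◁q q⊴k cp cq →
        interval-induction Goal step p◁q i⊴p q⊴k cp cq)
      where
      Goal : Pos n → Pos n → Set
      Goal p q = i ⊴ p → q ⊴ k → col i k p ≡ true → col i k q ≡ false → y · q ℤ.< y · p
      step : ∀ {p q} → p ◁ q → (∀ {r} → p ◁ r → r ◁ q → Goal p r) →
        (∀ {r} → p ◁ r → r ◁ q → Goal r q) → Goal p q
      step {p} {q} p◁q recˡ recʳ i⊴p q⊴k cp cq with ℤP.<-cmp (y · p) (y · q)
      ... | tri> _ _ q<p = q<p
      ... | tri≈ _ p≡q _ = contradiction (subst (_◁ q) (injective p≡q) p◁q) ◁-irrefl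
      ... | tri< p<q _ _ = contradiction (arc p q i⊴p p◁q q⊴k cp cq)
          (ℤP.<-asym (under (col-distinct (◁⇒⊴ p◁q) cp cq) underY ⊴-refl p◁q ⊴-refl (inj₁ refl) (inj₁ refl)))
        where
        at-most : ∀ {r} → p ⊴ r → r ◁ q → r ≡ p ⊎ col p q r ≡ false → y · r ℤ.≤ y · p
        at-most p⊴r r◁q h with ⊴⇒≡⊎◁ p⊴r | h
        ... | inj₁ refl | _         = ℤP.≤-refl
        ... | inj₂ _    | inj₁ refl = ℤP.≤-refl
        ... | inj₂ p◁r  | inj₂ c    = ℤP.<⇒≤ (recˡ p◁r r◁q i⊴p (⊴-trans (◁⇒⊴ r◁q) q⊴k) cp
                (trans (sym (col-shrink i⊴p q⊴k cp cq p⊴r (◁⇒⊴ r◁q))) c))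
        at-least : ∀ {r} → p ◁ r → r ⊴ q → r ≡ q ⊎ col p q r ≡ true → y · q ℤ.≤ y · r
        at-least p◁r r⊴q h with ⊴⇒≡⊎◁ r⊴q | h
        ... | inj₁ refl | _         = ℤP.≤-refl
        ... | inj₂ _    | inj₁ refl = ℤP.≤-refl
        ... | inj₂ r◁q  | inj₂ c    = ℤP.<⇒≤ (recʳ p◁r r◁q (⊴-trans i⊴p (◁⇒⊴ p◁r)) q⊴k
                (trans (sym (col-shrink i⊴p q⊴k cp cq (◁⇒⊴ p◁r) r⊴q)) c) cq)
        underY : Under y p q
        underY p⊴r r◁s s⊴q lowR highS =
          ℤP.≤-<-trans (at-most p⊴r (◁-⊴-trans r◁s s⊴q) lowR)
            (ℤP.<-≤-trans p<q (at-least (⊴-◁-trans p⊴r r◁s) s⊴q highS))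

  -- A chain of inversions leading from the lower to the upper side of an arc
  -- must cross it in a single step.
  Under-join : ∀ {x z i k} → Under x i k → Under z i k → Under (join n x z) i k
  Under-join {x} {z} {i} {k} underX underZ {p} {q} i⊴p p◁q q⊴k lowP highQ =
    SignedPerm.≮⇒> (IsSPerm⇒SignedPerm (join-IsSPerm n x z)) {q} {p} (λ { refl → ◁-irrefl p◁q })
      (λ inv → no-chain i⊴p lowP (join-Inv-chain n x z p◁q inv))
    where
    no-step : ∀ {p q} → i ⊴ p → q ⊴ k → p ≡ i ⊎ col i k p ≡ false → q ≡ k ⊎ col i k q ≡ true →
      ¬ JoinInv n x z p q
    no-step i⊴p q⊴k lowP highQ (p◁q , inj₁ inv) = ℤP.<-asym inv (underX i⊴p p◁q q⊴k lowP highQ)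
    no-step i⊴p q⊴k lowP highQ (p◁q , inj₂ inv) = ℤP.<-asym inv (underZ i⊴p p◁q q⊴k lowP highQ)
    no-chain : ∀ {p} → i ⊴ p → p ≡ i ⊎ col i k p ≡ false → ¬ TransClosure (JoinInv n x z) p q
    no-chain i⊴p lowP [ e ] = no-step i⊴p q⊴k lowP highQ e
    no-chain i⊴p lowP (_∷_ {y = r} e t) with col i k r in cr
    ... | true  = no-step i⊴p (⊴-trans (◁⇒⊴ (Generated.T⇒◁ (join-generator n x z) t)) q⊴k)
                    lowP (inj₂ cr) e
    ... | false = no-chain (⊴-trans i⊴p (◁⇒⊴ (proj₁ e))) (inj₂ cr) t

  Under-⊇ : ∀ {x z} → IsSPerm n x → IsSPerm n z → Weak n x z → ∀ {i k} → Under z i k → Under x i k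
  Under-⊇ xPerm zPerm x≤z underZ i⊴p p◁q q⊴k lowP highQ =
    noninversion-⊇ xPerm zPerm x≤z p◁q (underZ i⊴p p◁q q⊴k lowP highQ)

  -- An arc over the join of `y` and `z` is over `y`, hence over `x`, and over `z`. By `Under-join`
  -- it is over the join of `x` and `z`.
  join-mono-≼ : ∀ {x y z} → IsSPerm n x → Increasing x → IsSPerm n y → IsSPerm n z →
    x ≼ y → join n x z ≼ join n y z
  join-mono-≼ {x} {y} {z} xPerm incr yPerm zPerm x≼y = Under-⊇⇒≼ JPerm (λ _ underJ → Under-join
      (≼⇒Under-⊇ xPerm incr x≼y (Under-⊇ yPerm JPerm (join-upperˡ n y z) underJ))
      (Under-⊇ zPerm JPerm (join-upperʳ n y z) underJ))
    where JPerm = join-IsSPerm n y z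

-- The Tamari elements

⁺-least : ∀ {k j} → k ℤ.< j → j ≢ 0ℤ → k ⁺ ℤ.≤ j
⁺-least {+ m} {j}      k<j _   = subst (ℤ._≤ j) (ℤP.+-comm 1ℤ (+ m)) (ℤP.i<j⇒suc[i]≤j k<j)
⁺-least { -[1+ suc m ]} k<j _  = ℤP.i<j⇒suc[i]≤j k<j
⁺-least { -[1+ zero ]} {+ zero}  _ j≢0 = contradiction refl j≢0
⁺-least { -[1+ zero ]} {+ suc _} _ _   = ℤ.+≤+ (s≤s z≤n)
⁺-least { -[1+ zero ]} { -[1+ _ ]} (ℤ.-<- ()) _

-- Consecutive values stay consecutive under negation, which carries descents to the opposite
-- positions.
⁺-neg : ∀ k → k ≢ 0ℤ → (- (k ⁺)) ⁺ ≡ - k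
⁺-neg (+ zero)       k≢0 = contradiction refl k≢0
⁺-neg (+ suc m)      _ rewrite ℕP.+-comm m 1 = refl
⁺-neg -[1+ zero ]    _ = refl
⁺-neg -[1+ suc m ]   _ = cong (+_ ∘ suc) (ℕP.+-comm m 1)

module Tamari {n} (1≤n : 1 ℕ.≤ n) (α : TypeBComp n) where
  open Arcs α

  base-triple : ∀ {x} i j k → i ◁ pos j → pos j ◁ k →
    lab i ≢ lab (pos j) → lab i ≢ lab k → lab (pos j) ≢ lab k →
    x · i ≡ (x · k) ⁺ → BaseTriple α x (val i) (val (pos j)) (val k)
  base-triple i j k ⟨ i<j ⟩ ⟨ j<k ⟩ i≢j i≢k j≢k adj
    rewrite lab≡blockLabel i | lab≡blockLabel (pos j) | lab≡blockLabel k =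
    val-InPM i , val-InPM (pos j) , val-InPM k , i<j , j<k , i≢j , i≢k , j≢k , ℤ.+<+ (s≤s z≤n) , adj

  pattern-base : ∀ {x} i j k → Pattern231 α x i j k → BaseTriple α x i j k
  pattern-base {x} i j k = go (split α)
    where
    go : ∀ s → (if s then SplitPattern α x i j k else JoinPattern α x i j k) → BaseTriple α x i j k
    go true  = proj₁
    go false = proj₁

  module _ {x} (tam : InTam α x) where
    private
      inHα = proj₁ tam
      perm = proj₁ inHα
      incr = InHα⇒Increasing 1≤n inHα
    open SignedPerm (IsSPerm⇒SignedPerm perm)

    -- Patterns have a positive middle position. A negative one reduces to it through the opposite
    -- triple, which swaps the two kinds of obstruction.
    no-obstruction : ∀ {i j k} → i ◁ j → j ◁ k → lab i ≢ lab j → lab i ≢ lab k → lab j ≢ lab k →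
      x · i ≡ (x · k) ⁺ → ¬ Obstruction x i j k
    no-obstruction {i} {pos j} {k} i◁j j◁k i≢j i≢k j≢k adj obs = proj₂ tam
      (val i , val (pos j) , val k ,
       obstruction⇒pattern i j k (base-triple {x} i j k i◁j j◁k i≢j i≢k j≢k adj) obs)
    no-obstruction {i} {neg j} {k} i◁j j◁k i≢j i≢k j≢k adj obs =
      no-obstruction {opp k} {pos j} {opp i} (opp-◁ j◁k) (opp-◁ i◁j)
        (j≢k ∘ sym ∘ lab-opp⁻ {k} {neg j}) (i≢k ∘ sym ∘ lab-opp⁻ {k} {i}) (i≢j ∘ sym ∘ lab-opp⁻ {neg j} {i})
        (trans (·-opp x k) (trans (sym (⁺-neg (x · k) (nonzero k)))
          (cong _⁺ (trans (cong -_ (sym adj)) (sym (·-opp x i))))))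
        (Sum.swap (Sum.map
          (λ (s , i<j) → trans (side-opp (neg j)) (cong not s) , ·-opp-< x {i} {neg j} i<j)
          (λ (s , j<k) → trans (side-opp (neg j)) (cong not s) , ·-opp-< x {neg j} {k} j<k) obs))

    -- As the values at `i` and `k` are consecutive, each position in between is above both or below
    -- both. Avoidance decides which for inner positions, and `incr` for the end blocks.
    descent⇒above : ∀ {i k} → i ◁ k → x · i ≡ (x · k) ⁺ → Above x i k
    descent⇒above {i} {k} i◁k adj = above i◁k i≢k (λ p q i⊴p p◁q q⊴k cp cq →
        ℤP.≤-<-trans (at-most (⊴-◁-trans i⊴p p◁q) q⊴k cq)
          (ℤP.<-≤-trans k<i (at-least i⊴p (◁-⊴-trans p◁q q⊴k) cp)))
      where
      k<i : x · k ℤ.< x · i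
      k<i = subst (x · k ℤ.<_) (sym adj) (⁺-> (x · k))
      i≢k : lab i ≢ lab k
      i≢k eq = ℤP.<-asym k<i (incr i◁k eq)
      outside : ∀ {r} → i ◁ r → r ◁ k → x · i ℤ.< x · r ⊎ x · r ℤ.< x · k
      outside {r} i◁r r◁k with ℤP.<-cmp (x · r) (x · k)
      ... | tri< r<k _ _ = inj₂ r<k
      ... | tri≈ _ r≡k _ = contradiction (subst (_◁ k) (injective r≡k) r◁k) ◁-irrefl
      ... | tri> _ _ k<r = inj₁ (ℤP.≤∧≢⇒< (subst (ℤ._≤ x · r) (sym adj) (⁺-least k<r (nonzero r)))
                             (λ i≡r → ◁-irrefl (subst (_◁ r) (injective i≡r) i◁r)))
      at-least : ∀ {r} → i ⊴ r → r ◁ k → col i k r ≡ true → x · i ℤ.≤ x · r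
      at-least {r} i⊴r r◁k c with ⊴⇒≡⊎◁ i⊴r
      ... | inj₁ refl = ℤP.≤-refl
      ... | inj₂ i◁r with outside i◁r r◁k | col-view i k r
      ...   | inj₁ i<r | _           = ℤP.<⇒≤ i<r
      ...   | inj₂ _   | start r≡i _ = ℤP.<⇒≤ (incr i◁r (sym r≡i))
      ...   | inj₂ _   | end _ _ c′  = contradiction (trans (sym c) c′) true≢false
      ...   | inj₂ r<k | inner r≢i r≢k c′ = contradiction (inj₂ (trans (sym c′) c , r<k))
                (no-obstruction i◁r r◁k (r≢i ∘ sym) i≢k r≢k adj)
      at-most : ∀ {r} → i ◁ r → r ⊴ k → col i k r ≡ false → x · r ℤ.≤ x · k
      at-most {r} i◁r r⊴k c with ⊴⇒≡⊎◁ r⊴k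
      ... | inj₁ refl = ℤP.≤-refl
      ... | inj₂ r◁k with outside i◁r r◁k | col-view i k r
      ...   | inj₂ r<k | _           = ℤP.<⇒≤ r<k
      ...   | inj₁ _   | start _ c′  = contradiction (trans (sym c′) c) true≢false
      ...   | inj₁ _   | end _ r≡k _ = ℤP.<⇒≤ (incr r◁k r≡k)
      ...   | inj₁ i<r | inner r≢i r≢k c′ = contradiction (inj₁ (trans (sym c′) c , i<r))
                (no-obstruction i◁r r◁k (r≢i ∘ sym) i≢k r≢k adj)

    -- Consecutive values suffice: non-inversions of `x` survive in `proj x` because it lies below
    -- `x`, and descents survive because they are arcs.
    proj-Tam : proj x ≡ x
    proj-Tam = adjacent-monotone⇒≡ perm (proj-IsSPerm x) adjacent
      where
      adjacent : ∀ p q → x · q ≡ (x · p) ⁺ → proj x · p ℤ.< proj x · q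
      adjacent p q adj with order p q | subst (x · p ℤ.<_) (sym adj) (⁺-> (x · p))
      ... | before p◁q | p<q = noninversion-⊇ (proj-IsSPerm x) perm (proj-≤ x) p◁q p<q
      ... | same refl  | p<q = contradiction p<q (ℤP.<-irrefl refl)
      ... | after q◁p  | _   = above-proj x (descent⇒above q◁p adj)

  -- A chain of two or more links would put a value strictly between two consecutive ones, so the
  -- descent is a single arc.
  descent⇒above-proj : ∀ x {i k} → i ◁ k → proj x · i ≡ (proj x · k) ⁺ → Above (proj x) i k
  descent⇒above-proj x {i} {k} i◁k adj
    with proj-chain x i◁k (subst (proj x · k ℤ.<_) (sym adj) (⁺-> (proj x · k)))
  ... | [ ab ] = above-⊆ (≼-proj x) ab
  ... | _∷_ {y = r} ab t = contradiction (above-proj x ab) (ℤP.≤⇒≯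
          (subst (ℤ._≤ proj x · r) (sym adj)
            (⁺-least (Generated.T⇒inversion (above-generator x) t) (nonzero r))))
    where open SignedPerm (IsSPerm⇒SignedPerm (proj-IsSPerm x))

  proj-avoids : ∀ x {i j k} → ¬ Pattern231 α (proj x) i j k
  proj-avoids x {i} {j} {k} pat with pattern-base i j k pat
  ... | inI , inJ , inK , i<j , j<k , i≢j , i≢k , j≢k , 0<j , adj
    with position {n = n} i inI | position {n = n} j inJ | position {n = n} k inK
  ... | p , refl | neg _ , refl | r , refl = contradiction 0<j λ ()
  ... | p , refl | pos q , refl | r , refl
    with descent⇒above-proj x {p} {r} ⟨ ℤP.<-trans i<j j<k ⟩ adj | pattern⇒obstruction p q r pat
  -- The arc demands an inversion of the middle position with the start if its side is `false`, and
  -- with the end if it is `true`. The obstruction denies exactly this.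
  ... | above _ _ arc | _ , obs = Sum.[
      (λ (s , p<q) → ℤP.<-asym p<q (arc p (pos q) ⊴-refl ⟨ i<j ⟩ (◁⇒⊴ ⟨ j<k ⟩) (col-start refl) (trans inner≡ s))) ,
      (λ (s , q<r) → ℤP.<-asym q<r (arc (pos q) r (◁⇒⊴ ⟨ i<j ⟩) ⟨ j<k ⟩ ⊴-refl (trans inner≡ s) (col-end r≢p refl))) ] obs
    where
    labels : ∀ p q → blockLabel α (val p) ≢ blockLabel α (val q) → lab p ≢ lab q
    labels p q p≢q eq = p≢q (trans (sym (lab≡blockLabel p)) (trans eq (lab≡blockLabel q)))
    r≢p : lab r ≢ lab p
    r≢p = labels p r i≢k ∘ sym
    inner≡ : col p r (pos q) ≡ side (pos q)
    inner≡ = col-inner (labels p (pos q) i≢j ∘ sym) (labels (pos q) r j≢k)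

  proj-InTam : ∀ {x} → InHα α x → InTam α (proj x)
  proj-InTam {x} inHα =
    InHα-⊆ α 1≤n (proj-IsSPerm x) (proj-≤ x) inHα , (λ (i , j , k , pat) → proj-avoids x pat)

  -- The lattices, the congruence and the quotient

  _≤ᵂ_ : List ℤ → List ℤ → Set
  u ≤ᵂ v = u ≤weak[ n ] v

  Hα-meet : ∀ {x y} → InHα α x → InHα α y → IsMeet (InHα α) _≤ᵂ_ x y (meet n x y)
  Hα-meet xH@(xPerm , _) (yPerm , _) =
    InHα-⊆ α 1≤n (meet-IsSPerm xPerm yPerm) (meet-lowerˡ xPerm yPerm) xH ,
    Weak⇒≤weak (meet-lowerˡ xPerm yPerm) ,
    Weak⇒≤weak (meet-lowerʳ xPerm yPerm) ,
    (λ z (zPerm , _) z≤x z≤y →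
      Weak⇒≤weak (meet-greatest xPerm yPerm zPerm (≤weak⇒Weak z≤x) (≤weak⇒Weak z≤y)))

  Hα-join : ∀ {x y} → InHα α x → InHα α y → IsJoin (InHα α) _≤ᵂ_ x y (join n x y)
  Hα-join {x} {y} xH yH =
    join-InHα α 1≤n xH yH ,
    Weak⇒≤weak (join-upperˡ n x y) ,
    Weak⇒≤weak (join-upperʳ n x y) ,
    (λ z zH x≤z y≤z → Weak⇒≤weak (join-least n x y (≤weak⇒Weak x≤z) (≤weak⇒Weak y≤z)))

  Hα-lattice : IsLattice (InHα α) _≤ᵂ_
  Hα-lattice x y xH yH = (meet n x y , Hα-meet xH yH) , (join n x y , Hα-join xH yH)

  proj-retract-≤ : ∀ {x y} → InTam α x → Weak n x y → Weak n x (proj y)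
  proj-retract-≤ {y = y} xT x≤y = subst (λ v → Weak n v (proj y)) (proj-Tam xT) (proj-mono (Weak⇒≼ x≤y))

  -- Project the weak meet and join. By `proj-retract-≤` a Tamari element below `y` is below
  -- `proj y`, which keeps the projected meet greatest and the projected join an upper bound.
  Tam-lattice : IsLattice (InTam α) _≤ᵂ_
  Tam-lattice x y xT@(xH , _) yT@(yH , _) =
    (proj (meet n x y) ,
      proj-InTam (proj₁ (Hα-meet xH yH)) ,
      Weak⇒≤weak (Weak-trans (proj-≤ _) (meet-lowerˡ (proj₁ xH) (proj₁ yH))) ,
      Weak⇒≤weak (Weak-trans (proj-≤ _) (meet-lowerʳ (proj₁ xH) (proj₁ yH))) ,
      (λ z zT z≤x z≤y → Weak⇒≤weak (proj-retract-≤ zT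
        (meet-greatest (proj₁ xH) (proj₁ yH) (proj₁ (proj₁ zT)) (≤weak⇒Weak z≤x) (≤weak⇒Weak z≤y))))) ,
    (proj (join n x y) ,
      proj-InTam (proj₁ (Hα-join xH yH)) ,
      Weak⇒≤weak (proj-retract-≤ xT (join-upperˡ n x y)) ,
      Weak⇒≤weak (proj-retract-≤ yT (join-upperʳ n x y)) ,
      (λ z zT x≤z y≤z → Weak⇒≤weak (Weak-trans (proj-≤ _)
        (join-least n x y (≤weak⇒Weak x≤z) (≤weak⇒Weak y≤z)))))

  Θ : List ℤ → List ℤ → Set
  Θ x y = x ≼ y × y ≼ x

  -- `proj m` lies below `proj y`, hence below `y`, and below `z`. So it lies below `m′`, while
  -- `m ≼ proj m`.
  meets-≼ : ∀ {x y z m m′} → InHα α x → InHα α y → x ≼ y →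
    IsMeet (InHα α) _≤ᵂ_ x z m → IsMeet (InHα α) _≤ᵂ_ y z m′ → m ≼ m′
  meets-≼ {y = y} {m = m} xH yH x≼y (mH , m≤x , m≤z , _) (_ , _ , _ , greatest) =
    ≼-trans (≼-proj m) (Weak⇒≼ (≤weak⇒Weak (greatest (proj m) (proj₁ (proj-InTam mH))
      (Weak⇒≤weak (Weak-trans (proj-mono (≼-trans (Weak⇒≼ (≤weak⇒Weak m≤x)) x≼y)) (proj-≤ y)))
      (Weak⇒≤weak (Weak-trans (proj-≤ m) (≤weak⇒Weak m≤z))))))

  joins-≼ : ∀ {x y z m m′} → InHα α x → InHα α y → InHα α z → x ≼ y →
    IsJoin (InHα α) _≤ᵂ_ x z m → IsJoin (InHα α) _≤ᵂ_ y z m′ → m ≼ m′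
  joins-≼ {x} {y} {z} xH yH zH x≼y (_ , _ , _ , least) (_ , y≤m′ , z≤m′ , _) =
    ≼-trans (Weak⇒≼ (≤weak⇒Weak (least (join n x z) (join-InHα α 1≤n xH zH)
              (Weak⇒≤weak (join-upperˡ n x z)) (Weak⇒≤weak (join-upperʳ n x z)))))
      (≼-trans (join-mono-≼ (proj₁ xH) (InHα⇒Increasing 1≤n xH) (proj₁ yH) (proj₁ zH) x≼y)
        (Weak⇒≼ (join-least n y z (≤weak⇒Weak y≤m′) (≤weak⇒Weak z≤m′))))

  Θ-congruence : IsLatticeCongruence (InHα α) _≤ᵂ_ Θ
  Θ-congruence =
    (λ x _ → ⟪ (λ ab → ab) ⟫ , ⟪ (λ ab → ab) ⟫) ,
    (λ x y _ _ (x≼y , y≼x) → y≼x , x≼y) ,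
    (λ x y z _ _ _ (x≼y , y≼x) (y≼z , z≼y) → ≼-trans x≼y y≼z , ≼-trans z≼y y≼x) ,
    (λ x y z m m′ xH yH _ (x≼y , y≼x) isM isM′ →
      meets-≼ xH yH x≼y isM isM′ , meets-≼ yH xH y≼x isM′ isM) ,
    (λ x y z m m′ xH yH zH (x≼y , y≼x) isJ isJ′ →
      joins-≼ xH yH zH x≼y isJ isJ′ , joins-≼ yH xH zH y≼x isJ′ isJ)

  proj-iso : QuotientIso (InHα α) _≤ᵂ_ Θ (InTam α) proj
  proj-iso =
    (λ x xH → proj-InTam xH) ,
    (λ y yT → y , proj₁ yT , proj-Tam yT) ,
    (λ x y _ _ → mk⇔
      (λ eq → proj-mono⁻ (subst (Weak n (proj x)) eq (weak (λ _ inv → inv))) ,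
              proj-mono⁻ (subst (Weak n (proj y)) (sym eq) (weak (λ _ inv → inv))))
      (λ (x≼y , y≼x) → Weak-antisym (proj-IsSPerm x) (proj-IsSPerm y) (proj-mono x≼y) (proj-mono y≼x))) ,
    (λ x y m xH yH (mH , m≤x , m≤y , greatest) → mk⇔
      (λ (_ , x≼m) → Weak⇒≤weak (proj-mono (≼-trans x≼m (Weak⇒≼ (≤weak⇒Weak m≤y)))))
      -- `proj x` is below both `x` and `y`, hence below their meet `m`, and `x ≼ proj x`.
      (λ fx≤fy → Weak⇒≼ (≤weak⇒Weak m≤x) ,
        ≼-trans (≼-proj x) (Weak⇒≼ (≤weak⇒Weak (greatest (proj x) (proj₁ (proj-InTam xH))
          (Weak⇒≤weak (proj-≤ x))
          (Weak⇒≤weak (Weak-trans (≤weak⇒Weak fx≤fy) (proj-≤ y))))))))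

theorem1 : (n : ℕ) → 1 ≤ n → (α : TypeBComp n) →
    IsLattice (InTam α) (λ u v → u ≤weak[ n ] v)
    × IsLattice (InHα α) (λ u v → u ≤weak[ n ] v)
    × Σ (List ℤ → List ℤ → Set) (λ Θ →
    IsLatticeCongruence (InHα α) (λ u v → u ≤weak[ n ] v) Θ
    × Σ (List ℤ → List ℤ) (λ f →
    QuotientIso (InHα α) (λ u v → u ≤weak[ n ] v) Θ (InTam α) f))
theorem1 n 1≤n α = Tam-lattice , Hα-lattice , Θ , Θ-congruence , proj , proj-iso
  where
  open Tamari 1≤n α
  open Arcs α using (proj)
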